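{- Let $m<-1$ be a square free integer with $m\equiv 2,3 \pmod 4$, let $\alpha$ be a root of $x^4-m$ (so $\alpha^4=m$), and let $K=\mathbb{Q}(\alpha)$. Then, up to equivalence, $\alpha$ is the only generator of power integral bases in $K$.
   Context: For a number field $K$ of degree $n$ with ring of integers $\mathbb{Z}_K$, an element $\gamma\in\mathbb{Z}_K$ generates a power integral basis if $\{1,\gamma,\gamma^2,\ldots,\gamma^{n-1}\}$ is an integral basis of $K$ (i.e. $\mathbb{Z}_K=\mathbb{Z}[\gamma]$). Two elements $\beta,\gamma\in\mathbb{Z}_K$ are called equivalent if $\beta+\gamma\in\mathbb{Z}$ or $\beta-\gamma\in\mathbb{Z}$; generators of power integral bases are considered only up to this equivalence. -}

module Defs where

open import Data.Nat as ℕ using (ℕ; zero; suc)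
open import Data.Nat.Divisibility using (_∣_)
open import Data.Integer as ℤ using (ℤ; ∣_∣)
open import Data.Rational as ℚ using (ℚ; 0ℚ; 1ℚ)
open import Data.Fin using (Fin)
import Data.Fin as Fin
open import Data.Product using (Σ; _×_; ∃; _,_)
open import Data.Sum using (_⊎_)
open import Relation.Binary.PropositionalEquality using (_≡_)

-- Elements of K = ℚ(α), α⁴ = m, written in the ℚ-basis 1, α, α², α³:
-- ⟨ a0 , a1 , a2 , a3 ⟩ stands for a0 + a1 α + a2 α² + a3 α³.
-- (x⁴ - m is irreducible over ℚ for squarefree m < -1 by Eisenstein,
-- so K ≅ ℚ[x]/(x⁴ - m) has degree 4 with this basis.)
record K : Set where
  constructor ⟨_,_,_,_⟩
  field
    c0 c1 c2 c3 : ℚ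

open K public

module Arith (m : ℤ) where
  private
    M : ℚ
    M = m ℚ./ 1

  infixl 6 _+K_
  infixl 7 _*K_

  _+K_ : K → K → K
  ⟨ a0 , a1 , a2 , a3 ⟩ +K ⟨ b0 , b1 , b2 , b3 ⟩ =
    ⟨ a0 ℚ.+ b0 , a1 ℚ.+ b1 , a2 ℚ.+ b2 , a3 ℚ.+ b3 ⟩

  -- multiplication using α⁴ = m
  _*K_ : K → K → K
  ⟨ a0 , a1 , a2 , a3 ⟩ *K ⟨ b0 , b1 , b2 , b3 ⟩ =
    ⟨ a0 ℚ.* b0 ℚ.+ M ℚ.* (a1 ℚ.* b3 ℚ.+ a2 ℚ.* b2 ℚ.+ a3 ℚ.* b1)
    , a0 ℚ.* b1 ℚ.+ a1 ℚ.* b0 ℚ.+ M ℚ.* (a2 ℚ.* b3 ℚ.+ a3 ℚ.* b2)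
    , a0 ℚ.* b2 ℚ.+ a1 ℚ.* b1 ℚ.+ a2 ℚ.* b0 ℚ.+ M ℚ.* (a3 ℚ.* b3)
    , a0 ℚ.* b3 ℚ.+ a1 ℚ.* b2 ℚ.+ a2 ℚ.* b1 ℚ.+ a3 ℚ.* b0 ⟩

  ι : ℤ → K
  ι k = ⟨ k ℚ./ 1 , 0ℚ , 0ℚ , 0ℚ ⟩

  0K 1K : K
  0K = ι (ℤ.+ 0)
  1K = ι (ℤ.+ 1)

  α : K
  α = ⟨ 0ℚ , 1ℚ , 0ℚ , 0ℚ ⟩

  -_K : K → K
  -_K ⟨ a0 , a1 , a2 , a3 ⟩ = ⟨ ℚ.- a0 , ℚ.- a1 , ℚ.- a2 , ℚ.- a3 ⟩

  _-K_ : K → K → K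
  x -K y = x +K (-_K y)

  _^K_ : K → ℕ → K
  x ^K zero = 1K
  x ^K suc n = x *K (x ^K n)

  lincomb : (d : ℕ) → (Fin d → ℤ) → K → K
  lincomb zero c γ = 0K
  lincomb (suc d) c γ = ι (c (Fin.fromℕ d)) *K (γ ^K d)
                         +K lincomb d (λ i → c (Fin.inject₁ i)) γ

  IsAlgInt : K → Set
  IsAlgInt x = Σ ℕ λ d → Σ (Fin d → ℤ) λ c → (x ^K d) +K lincomb d c x ≡ 0K

  GeneratesPowerIntegralBasis : K → Set
  GeneratesPowerIntegralBasis γ =
    IsAlgInt γ
    × (∀ x → IsAlgInt x → Σ (Fin 4 → ℤ) λ c → x ≡ lincomb 4 c γ)
    × (∀ (c : Fin 4 → ℤ) → lincomb 4 c γ ≡ 0K → ∀ i → c i ≡ ℤ.+ 0)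

  Equivalent : K → K → Set
  Equivalent β γ = (∃ λ k → β +K γ ≡ ι k) ⊎ (∃ λ k → β -K γ ≡ ι k)

open Arith public

SquareFree : ℤ → Set
SquareFree m = ∀ (d : ℕ) → (d ℕ.* d) ∣ ∣ m ∣ → d ≡ 1

{-# OPTIONS --safe #-}

-- An algebraic integer x has powers with a common denominator, and the elements
-- with this property form a ring stable under conjugation.  Applied to traces and
-- norms, first in ℚ(√m) and then for α ↦ -α on K, this forces the coordinates of 2x
-- to be integers (m is squarefree); congruences modulo 4 then force those of x.
--
-- If γ = a + xα + yα² + zα³ generates and α = k₀ + k₁γ + k₂γ² + k₃γ³, the odd part of
-- the right-hand side is (xα + zα³)(u + vα²) with integers u and v.  Hence x + zα² is a
-- unit of ℤ[√m], so x = ±1 and z = 0 because m < -1.  The coefficients of α² and α³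
-- then give k₃(1 + 4my⁴) = 2xy², so 1 + 4my⁴ divides 1 and y = 0.
module Submission where

open import Defs
import Algebra.Properties.AbelianGroup
import Algebra.Properties.CommutativeSemigroup
import Algebra.Properties.Ring
import Algebra.Solver.Ring.NaturalCoefficients.Default
open import Algebra.Bundles using (CommutativeRing)
open import Algebra.Structures using (IsCommutativeRing)
open import Data.Empty using (⊥-elim)
open import Data.Fin as Fin using (Fin; toℕ)
open import Data.Fin.Patterns using (0F; 1F; 2F; 3F)
import Data.Fin.Properties as Fin
import Data.Integer
open import Data.Integer as ℤ using (ℤ; _<_; -[1+_]; +_; 0ℤ; 1ℤ; -1ℤ; ∣_∣; -<-)
open import Data.Integer.Divisibility.Signed
  using (_∣_; _∣?_; divides; ∣m∣n⇒∣m+n; ∣m∣n⇒∣m-n; ∣m⇒∣-m; ∣m⇒∣m*n; ∣n⇒∣m*n)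
import Data.Integer.DivMod as ℤ
open import Data.Integer.DivMod using (_%ℕ_)
import Data.Integer.Properties as ℤ
open import Data.Integer.Tactic.RingSolver using () renaming (solve-∀ to solve-ℤ)
open import Data.Nat as ℕ using (ℕ; zero; suc; z≤n; s≤s)
open import Data.Nat.Coprimality using (Coprime; recompute; coprime-divisor) renaming (sym to coprime-sym)
open import Data.Nat.Divisibility using (divides; 1∣_; ∣⇒≤; *-monoˡ-∣; *-monoʳ-∣)
  renaming (_∣_ to _∣ℕ_; module _∣_ to ∣ℕ)
import Data.Nat.Properties as ℕ
open import Data.Product using (_×_; _,_; ∃; Σ; proj₁; proj₂)
import Data.Rational
open import Data.Rational as ℚ using (ℚ; 0ℚ; 1ℚ; ½; _/_; ↥_; ↧_; ↧ₙ_; mkℚ; toℚᵘ)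
import Data.Rational.Properties as ℚ
open import Data.Rational.Unnormalised as ℚᵘ using (mkℚᵘ; _≃_; *≡*)
import Data.Rational.Unnormalised.Properties as ℚᵘ
open import Data.Sum using (_⊎_; inj₁; inj₂; [_,_]′)
open import Relation.Binary.PropositionalEquality
open import Relation.Nullary using (yes; no; contradiction)
open import Relation.Nullary.Decidable using (dec⇒maybe; from-yes; from-no; _→-dec_; _×-dec_)
open import Tactic.RingSolver using (solve-∀)
open import Tactic.RingSolver.Core.AlmostCommutativeRing using (AlmostCommutativeRing; fromCommutativeRing)

open Algebra.Properties.AbelianGroup ℤ.+-0-abelianGroup using (∙-cancelˡ)

-- Closure of the algebraic integers under sums and products is usually drawn from finitely
-- generated modules or resultants. One denominator common to all powers replaces both: a sum needs
-- only an induction, and a rational number with this property is an integer, since otherwise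
-- arbitrarily high powers of its denominator would divide a fixed nonzero integer. Traces and norms
-- descend from K to ℚ(√m) and from there to ℚ, where this applies.
--
-- The factorisation of the odd part has a structural source. Let f be the cubic with coefficients
-- kᵢ and σ the conjugation α ↦ -α. Then f(γ) - f(σγ) is divisible by γ - σγ = 2(xα + zα³), and the
-- quotient is symmetric in γ and σγ, hence lies in ℤ[α²]; for f(γ) = α the difference is 2α.
--
-- The number 1 + 4my⁴ comes from the index form: for z = 0 the determinant of the coordinates of γ,
-- γ², γ³ at α, α², α³ is x²(x⁴ + 4my⁴).

ℚ-ring : AlmostCommutativeRing _ _
ℚ-ring = fromCommutativeRing ℚ.+-*-commutativeRing λ q → dec⇒maybe (0ℚ ℚ.≟ q)

-- Integers inside the rationals

toℚᵘ-/1 : ∀ i → toℚᵘ (i / 1) ≃ mkℚᵘ i 0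
toℚᵘ-/1 i = ℚ.toℚᵘ-fromℚᵘ (mkℚᵘ i 0)

/1-injective : ∀ {i j} → i / 1 ≡ j / 1 → i ≡ j
/1-injective {i} {j} eq with ℚ./-injective-≃ (mkℚᵘ i 0) (mkℚᵘ j 0) eq
... | *≡* i*1≡j*1 = ℤ.*-cancelʳ-≡ i j (+ 1) i*1≡j*1

infix 4 _≐_

-- A record rather than q ≡ i / 1 itself, so that i can be inferred.
record _≐_ (q : ℚ) (i : ℤ) : Set where
  constructor int
  field equality : q ≡ i / 1

≐-unique : ∀ {q i j} → q ≐ i → q ≐ j → i ≡ j
≐-unique (int q≡i) (int q≡j) = /1-injective (trans (sym q≡i) q≡j)

infixl 6 _⊕_
infixl 7 _⊗_
infix 8 ⊖_

-- Normalising `i / 1` runs a gcd computation that is stuck on a variable, so the comparison is made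
-- between unnormalised rationals.
_⊕_ : ∀ {p q i j} → p ≐ i → q ≐ j → p ℚ.+ q ≐ i ℤ.+ j
_⊕_ {i = i} {j} (int refl) (int refl) = int (ℚ.toℚᵘ-injective (begin
  toℚᵘ ((i / 1) ℚ.+ (j / 1))        ≈⟨ ℚ.toℚᵘ-homo-+ (i / 1) (j / 1) ⟩
  toℚᵘ (i / 1) ℚᵘ.+ toℚᵘ (j / 1)    ≈⟨ ℚᵘ.+-cong (toℚᵘ-/1 i) (toℚᵘ-/1 j) ⟩
  mkℚᵘ i 0 ℚᵘ.+ mkℚᵘ j 0            ≈⟨ *≡* (cong (ℤ._* + 1) (cong₂ ℤ._+_ (ℤ.*-identityʳ i) (ℤ.*-identityʳ j))) ⟩
  mkℚᵘ (i ℤ.+ j) 0                  ≈⟨ toℚᵘ-/1 (i ℤ.+ j) ⟨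
  toℚᵘ ((i ℤ.+ j) / 1)              ∎))
  where open import Relation.Binary.Reasoning.Setoid ℚᵘ.≃-setoid

_⊗_ : ∀ {p q i j} → p ≐ i → q ≐ j → p ℚ.* q ≐ i ℤ.* j
_⊗_ {i = i} {j} (int refl) (int refl) = int (ℚ.toℚᵘ-injective (begin
  toℚᵘ ((i / 1) ℚ.* (j / 1))        ≈⟨ ℚ.toℚᵘ-homo-* (i / 1) (j / 1) ⟩
  toℚᵘ (i / 1) ℚᵘ.* toℚᵘ (j / 1)    ≈⟨ ℚᵘ.*-cong (toℚᵘ-/1 i) (toℚᵘ-/1 j) ⟩
  mkℚᵘ i 0 ℚᵘ.* mkℚᵘ j 0            ≈⟨ *≡* refl ⟩
  mkℚᵘ (i ℤ.* j) 0                  ≈⟨ toℚᵘ-/1 (i ℤ.* j) ⟨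
  toℚᵘ ((i ℤ.* j) / 1)              ∎))
  where open import Relation.Binary.Reasoning.Setoid ℚᵘ.≃-setoid

⊖_ : ∀ {p i} → p ≐ i → ℚ.- p ≐ ℤ.- i
⊖_ {i = i} (int refl) = int (ℚ.toℚᵘ-injective (begin
  toℚᵘ (ℚ.- (i / 1))    ≈⟨ ℚ.toℚᵘ-homo‿- (i / 1) ⟩
  ℚᵘ.- toℚᵘ (i / 1)     ≈⟨ ℚᵘ.-‿cong (toℚᵘ-/1 i) ⟩
  mkℚᵘ (ℤ.- i) 0        ≈⟨ toℚᵘ-/1 (ℤ.- i) ⟨
  toℚᵘ ((ℤ.- i) / 1)    ∎))
  where open import Relation.Binary.Reasoning.Setoid ℚᵘ.≃-setoid

IsInt : ℚ → Set
IsInt q = ∃ λ i → q ≐ i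

IsInt-+ : ∀ {p q} → IsInt p → IsInt q → IsInt (p ℚ.+ q)
IsInt-+ (_ , p) (_ , q) = _ , p ⊕ q

IsInt-* : ∀ {p q} → IsInt p → IsInt q → IsInt (p ℚ.* q)
IsInt-* (_ , p) (_ , q) = _ , p ⊗ q

IsInt-neg : ∀ {p} → IsInt p → IsInt (ℚ.- p)
IsInt-neg (_ , p) = _ , ⊖ p

K-ext : ∀ {a b c d a′ b′ c′ d′} → a ≡ a′ → b ≡ b′ → c ≡ c′ → d ≡ d′ →
        ⟨ a , b , c , d ⟩ ≡ ⟨ a′ , b′ , c′ , d′ ⟩
K-ext refl refl refl refl = refl

*-↧ : ∀ q → q ℚ.* (↧ q / 1) ≡ ↥ q / 1
*-↧ q@(mkℚ n d-1 _) = ℚ.toℚᵘ-injective (begin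
  ℚ.toℚᵘ (q ℚ.* (↧ q / 1))              ≈⟨ ℚ.toℚᵘ-homo-* q (↧ q / 1) ⟩
  mkℚᵘ n d-1 ℚᵘ.* ℚ.toℚᵘ (↧ q / 1)      ≈⟨ ℚᵘ.*-congˡ {mkℚᵘ n d-1} (toℚᵘ-/1 (↧ q)) ⟩
  mkℚᵘ n d-1 ℚᵘ.* mkℚᵘ (↧ q) 0          ≈⟨ *≡* (trans (ℤ.*-identityʳ (n ℤ.* ↧ q)) (cong (λ e → n ℤ.* + e) (sym (ℕ.*-identityʳ (suc d-1))))) ⟩
  mkℚᵘ n 0                              ≈⟨ toℚᵘ-/1 n ⟨
  ℚ.toℚᵘ (n / 1)                        ∎)
  where open import Relation.Binary.Reasoning.Setoid ℚᵘ.≃-setoid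

/1-int : ∀ i → IsInt (i / 1)
/1-int i = i , int refl

/1-* : ∀ i j → (i / 1) ℚ.* (j / 1) ≡ (i ℤ.* j) / 1
/1-* i j = _≐_.equality (_⊗_ {i = i} {j} (int refl) (int refl))

-- Integrality criteria for a rational number

n<2^n : ∀ n → n ℕ.< 2 ℕ.^ n
n<2^n zero = s≤s z≤n
n<2^n (suc n) = ℕ.<-≤-trans (s≤s (n<2^n n)) (ℕ.+-mono-≤ (ℕ.m^n>0 2 n) (ℕ.≤-reflexive (sym (ℕ.+-identityʳ _))))

-- Coprimality makes q divide every term; the quotients satisfy the same recurrence, so one more
-- factor q can be split off each time.
geometric⇒^∣ : ∀ {p q} .{{_ : ℕ.NonZero q}} → Coprime q p → ∀ j (s : ℕ → ℕ) →
               (∀ k → q ℕ.* s (suc k) ≡ p ℕ.* s k) → q ℕ.^ j ∣ℕ s 0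
geometric⇒^∣ q⊥p zero s ratio = 1∣ s 0
geometric⇒^∣ {p} {q} q⊥p (suc j) s ratio = subst (q ℕ.^ suc j ∣ℕ_) (sym (s≡q*t 0))
  (*-monoʳ-∣ q (geometric⇒^∣ q⊥p j t ratio-t))
  where
  q∣s : ∀ k → q ∣ℕ s k
  q∣s k = coprime-divisor q⊥p (divides (s (suc k)) (trans (sym (ratio k)) (ℕ.*-comm q _)))

  t : ℕ → ℕ
  t k = ∣ℕ.quotient (q∣s k)

  s≡q*t : ∀ k → s k ≡ q ℕ.* t k
  s≡q*t k = trans (∣ℕ.equality (q∣s k)) (ℕ.*-comm (t k) q)

  ratio-t : ∀ k → q ℕ.* t (suc k) ≡ p ℕ.* t k
  ratio-t k = ℕ.*-cancelˡ-≡ _ _ q (begin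
    q ℕ.* (q ℕ.* t (suc k))  ≡⟨ cong (q ℕ.*_) (s≡q*t (suc k)) ⟨
    q ℕ.* s (suc k)          ≡⟨ ratio k ⟩
    p ℕ.* s k                ≡⟨ cong (p ℕ.*_) (s≡q*t k) ⟩
    p ℕ.* (q ℕ.* t k)        ≡⟨ x∙yz≈y∙xz p q (t k) ⟩
    q ℕ.* (p ℕ.* t k)        ∎)
    where
    open ≡-Reasoning
    open Algebra.Properties.CommutativeSemigroup ℕ.*-commutativeSemigroup using (x∙yz≈y∙xz)

↧ₙ≡1⇒IsInt : ∀ q → ↧ₙ q ≡ 1 → IsInt q
↧ₙ≡1⇒IsInt q ↧≡1 = ↥ q , int (trans (sym (ℚ.*-identityʳ q)) (trans (cong (λ d → q ℚ.* (+ d / 1)) (sym ↧≡1)) (*-↧ q)))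

↧⊥↥ : ∀ q → Coprime (↧ₙ q) ∣ ↥ q ∣
↧⊥↥ (mkℚ n d-1 c) = coprime-sym (recompute c)

↧ₙ-nonZero : ∀ q → ℕ.NonZero (↧ₙ q)
↧ₙ-nonZero (mkℚ _ _ _) = _

-- Every power of the denominator of r divides the nonzero integer s 0. With the exponent |s 0|
-- itself, a denominator of at least 2 gives a divisor larger than the number it divides.
geometric⇒IsInt : ∀ r (s : ℕ → ℚ) → (∀ k → s (suc k) ≡ r ℚ.* s k) → (∀ k → IsInt (s k)) → s 0 ≢ 0ℚ → IsInt r
geometric⇒IsInt r s ratio s-int s₀≢0 = ↧ₙ≡1⇒IsInt r (≤1⇒≡1 (↧ₙ r) {{↧ₙ-nonZero r}} ↧≤1)
  where
  n : ℕ → ℤ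
  n k = proj₁ (s-int k)

  ≤1⇒≡1 : ∀ d .{{_ : ℕ.NonZero d}} → d ℕ.≤ 1 → d ≡ 1
  ≤1⇒≡1 (suc zero) _ = refl
  ≤1⇒≡1 (suc (suc _)) (s≤s ())

  cleared : ∀ k → ↧ r ℤ.* n (suc k) ≡ ↥ r ℤ.* n k
  cleared k = ≐-unique (_⊗_ {i = ↧ r} (int refl) (proj₂ (s-int (suc k)))) (subst (_≐ ↥ r ℤ.* n k) (begin
    (↥ r / 1) ℚ.* s k              ≡⟨ cong (ℚ._* s k) (*-↧ r) ⟨
    (r ℚ.* (↧ r / 1)) ℚ.* s k      ≡⟨ cong (ℚ._* s k) (ℚ.*-comm r (↧ r / 1)) ⟩
    ((↧ r / 1) ℚ.* r) ℚ.* s k      ≡⟨ ℚ.*-assoc (↧ r / 1) r (s k) ⟩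
    (↧ r / 1) ℚ.* (r ℚ.* s k)      ≡⟨ cong ((↧ r / 1) ℚ.*_) (ratio k) ⟨
    (↧ r / 1) ℚ.* s (suc k)        ∎) (_⊗_ {i = ↥ r} (int refl) (proj₂ (s-int k))))
    where open ≡-Reasoning

  ↧^∣ : ∀ j → ↧ₙ r ℕ.^ j ∣ℕ ∣ n 0 ∣
  ↧^∣ j = geometric⇒^∣ {{↧ₙ-nonZero r}} (↧⊥↥ r) j (λ k → ∣ n k ∣) λ k →
    trans (sym (ℤ.abs-* (↧ r) (n (suc k)))) (trans (cong ∣_∣ (cleared k)) (ℤ.abs-* (↥ r) (n k)))

  n₀≢0 : ∣ n 0 ∣ ≢ 0
  n₀≢0 ∣n₀∣≡0 = s₀≢0 (trans (_≐_.equality (proj₂ (s-int 0))) (cong (_/ 1) (ℤ.∣i∣≡0⇒i≡0 {n 0} ∣n₀∣≡0)))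

  ↧≤1 : ↧ₙ r ℕ.≤ 1
  ↧≤1 with ↧ₙ r ℕ.≤? 1
  ... | yes ↧≤1 = ↧≤1
  ... | no ↧≰1 = ⊥-elim (ℕ.<-irrefl refl (begin-strict
    ∣ n 0 ∣                 <⟨ n<2^n ∣ n 0 ∣ ⟩
    2 ℕ.^ ∣ n 0 ∣           ≤⟨ ℕ.^-monoˡ-≤ ∣ n 0 ∣ (ℕ.≰⇒> ↧≰1) ⟩
    ↧ₙ r ℕ.^ ∣ n 0 ∣        ≤⟨ ∣⇒≤ {{ℕ.≢-nonZero n₀≢0}} (↧^∣ ∣ n 0 ∣) ⟩
    ∣ n 0 ∣                 ∎))
    where open ℕ.≤-Reasoning

a*bb*cc≡a*bc*bc : ∀ a b c → (a ℚ.* (b ℚ.* b)) ℚ.* (c ℚ.* c) ≡ a ℚ.* ((b ℚ.* c) ℚ.* (b ℚ.* c))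
a*bb*cc≡a*bc*bc = solve-∀ ℚ-ring

-- For s = p/q in lowest terms, p²m = nq². As q is coprime to p, it divides m; with m = tq what
-- remains is p²t = nq, so q divides t as well and q² divides m.
squarefree⇒IsInt : ∀ {m} → SquareFree m → ∀ s → IsInt ((m / 1) ℚ.* (s ℚ.* s)) → IsInt s
squarefree⇒IsInt {m} m-squarefree s (n , ms²≐n) = ↧ₙ≡1⇒IsInt s (m-squarefree (↧ₙ s) q²∣m)
  where
  p = ∣ ↥ s ∣
  q = ↧ₙ s

  cleared : m ℤ.* (↥ s ℤ.* ↥ s) ≡ n ℤ.* (↧ s ℤ.* ↧ s)
  cleared = ≐-unique (_⊗_ {i = m} (int refl) (_⊗_ {i = ↥ s} {↥ s} (int refl) (int refl))) (subst (_≐ n ℤ.* (↧ s ℤ.* ↧ s))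
    (trans (a*bb*cc≡a*bc*bc (m / 1) s (↧ s / 1)) (cong (λ e → (m / 1) ℚ.* (e ℚ.* e)) (*-↧ s)))
    (ms²≐n ⊗ _⊗_ {i = ↧ s} {↧ s} (int refl) (int refl)))

  cleared-ℕ : p ℕ.* (p ℕ.* ∣ m ∣) ≡ ∣ n ∣ ℕ.* q ℕ.* q
  cleared-ℕ = begin
    p ℕ.* (p ℕ.* ∣ m ∣)              ≡⟨ regroup p ∣ m ∣ ⟩
    ∣ m ∣ ℕ.* (p ℕ.* p)              ≡⟨ cong (∣ m ∣ ℕ.*_) (ℤ.abs-* (↥ s) (↥ s)) ⟨
    ∣ m ∣ ℕ.* ∣ ↥ s ℤ.* ↥ s ∣        ≡⟨ ℤ.abs-* m _ ⟨
    ∣ m ℤ.* (↥ s ℤ.* ↥ s) ∣          ≡⟨ cong ∣_∣ cleared ⟩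
    ∣ n ℤ.* (↧ s ℤ.* ↧ s) ∣          ≡⟨ ℤ.abs-* n _ ⟩
    ∣ n ∣ ℕ.* ∣ ↧ s ℤ.* ↧ s ∣        ≡⟨ cong (∣ n ∣ ℕ.*_) (ℤ.abs-* (↧ s) (↧ s)) ⟩
    ∣ n ∣ ℕ.* (q ℕ.* q)              ≡⟨ ℕ.*-assoc ∣ n ∣ q q ⟨
    ∣ n ∣ ℕ.* q ℕ.* q                ∎
    where
    open ≡-Reasoning
    regroup : ∀ p m → p ℕ.* (p ℕ.* m) ≡ m ℕ.* (p ℕ.* p)
    regroup p m = trans (sym (ℕ.*-assoc p p m)) (ℕ.*-comm (p ℕ.* p) m)

  instance
    q-nonZero : ℕ.NonZero q
    q-nonZero = ↧ₙ-nonZero s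

  q∣m : q ∣ℕ ∣ m ∣
  q∣m = coprime-divisor (↧⊥↥ s) (coprime-divisor (↧⊥↥ s) (divides (∣ n ∣ ℕ.* q) cleared-ℕ))

  q²∣m : q ℕ.* q ∣ℕ ∣ m ∣
  q²∣m = subst (q ℕ.* q ∣ℕ_) (sym (∣ℕ.equality q∣m)) (*-monoˡ-∣ q
    (coprime-divisor (↧⊥↥ s) (coprime-divisor (↧⊥↥ s) (divides ∣ n ∣
      (ℕ.*-cancelʳ-≡ _ _ q (trans (regroup p t q) (trans (cong (λ e → p ℕ.* (p ℕ.* e)) (sym (∣ℕ.equality q∣m))) cleared-ℕ)))))))
    where
    t = ∣ℕ.quotient q∣m
    regroup : ∀ p t q → p ℕ.* (p ℕ.* t) ℕ.* q ≡ p ℕ.* (p ℕ.* (t ℕ.* q))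
    regroup p t q = trans (ℕ.*-assoc p (p ℕ.* t) q) (cong (p ℕ.*_) (ℕ.*-assoc p t q))

-- Congruences modulo 4

module Parity where
  open Data.Integer using (_+_; _*_; _-_; -_)

  infix 4 _≡₄_

  record _≡₄_ (i j : ℤ) : Set where
    constructor mod4
    field ∣-difference : + 4 ∣ i - j

  ≡₄-+ : ∀ {i j k l} → i ≡₄ j → k ≡₄ l → i + k ≡₄ j + l
  ≡₄-+ {i} {j} {k} {l} (mod4 i≡j) (mod4 k≡l) =
    mod4 (subst (+ 4 ∣_) (sym (regroup i j k l)) (∣m∣n⇒∣m+n i≡j k≡l))
    where
    regroup : ∀ i j k l → i + k - (j + l) ≡ (i - j) + (k - l)
    regroup = solve-ℤ

  ≡₄-neg : ∀ {i j} → i ≡₄ j → - i ≡₄ - j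
  ≡₄-neg {i} {j} (mod4 i≡j) = mod4 (subst (+ 4 ∣_) (ℤ.neg-distrib-+ i (- j)) (∣m⇒∣-m i≡j))

  ≡₄-* : ∀ {i j k l} → i ≡₄ j → k ≡₄ l → i * k ≡₄ j * l
  ≡₄-* {i} {j} {k} {l} (mod4 i≡j) (mod4 k≡l) =
    mod4 (subst (+ 4 ∣_) (sym (regroup i j k l)) (∣m∣n⇒∣m+n (∣m⇒∣m*n k i≡j) (∣n⇒∣m*n j k≡l)))
    where
    regroup : ∀ i j k l → i * k - j * l ≡ (i - j) * k + j * (k - l)
    regroup = solve-ℤ

  ≡₄⇒∣ : ∀ {i j} → i ≡₄ j → + 4 ∣ i → + 4 ∣ j
  ≡₄⇒∣ {i} {j} (mod4 i≡j) 4∣i = subst (+ 4 ∣_) (sym (regroup i j)) (∣m∣n⇒∣m-n 4∣i i≡j)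
    where
    regroup : ∀ i j → j ≡ i - (i - j)
    regroup = solve-ℤ

  bit : Fin 2 → ℤ
  bit b = + toℕ b

  record Halved (i : ℤ) : Set where
    constructor halved
    field
      parity : Fin 2
      half : ℤ
      equality : i ≡ bit parity + half * + 2

  halve : ∀ i → Halved i
  halve i = halved (Fin.fromℕ< (ℤ.n%ℕd<d i 2)) (i ℤ./ℕ 2)
    (trans (ℤ.a≡a%ℕn+[a/ℕn]*n i 2) (cong (λ r → + r + (i ℤ./ℕ 2) * + 2) (sym (Fin.toℕ-fromℕ< (ℤ.n%ℕd<d i 2)))))

  open Halved

  -- Modulo 4, squares and doubled products depend only on parities. The forms below are built from
  -- these two kinds of terms and m, so testing them on bits suffices.
  twice-product : ∀ {i k} (i′ : Halved i) (k′ : Halved k) →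
                  + 2 * (i * k) ≡₄ + 2 * (bit (parity i′) * bit (parity k′))
  twice-product (halved r h refl) (halved s l refl) =
    mod4 (divides (h * bit s + bit r * l + + 2 * (h * l)) (expand (bit r) (bit s) h l))
    where
    expand : ∀ r s h l → + 2 * ((r + h * + 2) * (s + l * + 2)) - + 2 * (r * s)
                       ≡ (h * s + r * l + + 2 * (h * l)) * + 4
    expand = solve-ℤ

  square : ∀ {i} (i′ : Halved i) → i * i ≡₄ bit (parity i′) * bit (parity i′)
  square (halved r h refl) = mod4 (divides (bit r * h + h * h) (expand (bit r) h))
    where
    expand : ∀ r h → (r + h * + 2) * (r + h * + 2) - r * r ≡ (r * h + h * h) * + 4
    expand = solve-ℤ

  Even : ℤ → Set
  Even i = ∃ λ j → i ≡ j * + 2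

  parity-zero⇒Even : ∀ {i} (i′ : Halved i) → parity i′ ≡ Fin.zero → Even i
  parity-zero⇒Even (halved r h refl) refl = h , ℤ.+-identityˡ (h * + 2)

  residue : Fin 2 → ℤ
  residue b = + 2 + bit b

  2-or-3 : ∀ m → (m %ℕ 4 ≡ 2 ⊎ m %ℕ 4 ≡ 3) → ∃ λ b → m ≡₄ residue b
  2-or-3 m (inj₁ m%4≡2) = Fin.zero , mod4 (divides (m ℤ./ℕ 4)
    (trans (cong (_- + 2) (trans (ℤ.a≡a%ℕn+[a/ℕn]*n m 4) (cong (λ r → + r + (m ℤ./ℕ 4) * + 4) m%4≡2))) (cancel (m ℤ./ℕ 4))))
    where
    cancel : ∀ q → + 2 + q * + 4 - + 2 ≡ q * + 4
    cancel = solve-ℤ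
  2-or-3 m (inj₂ m%4≡3) = Fin.suc Fin.zero , mod4 (divides (m ℤ./ℕ 4)
    (trans (cong (_- + 3) (trans (ℤ.a≡a%ℕn+[a/ℕn]*n m 4) (cong (λ r → + r + (m ℤ./ℕ 4) * + 4) m%4≡3))) (cancel (m ℤ./ℕ 4))))
    where
    cancel : ∀ q → + 3 + q * + 4 - + 3 ≡ q * + 4
    cancel = solve-ℤ

  -- Eight cases, decided by evaluation. A residue 1 would let r = s = 1 pass, which is the integer
  -- (1 + √m)/2 of the case m ≡ 1.
  quadratic-check : ∀ b (r s : Fin 2) → + 4 ∣ bit r * bit r - residue b * (bit s * bit s) → r ≡ Fin.zero × s ≡ Fin.zero
  quadratic-check = from-yes (Fin.all? λ b → Fin.all? λ r → Fin.all? λ s →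
    (+ 4 ∣? bit r * bit r - residue b * (bit s * bit s)) →-dec ((r Fin.≟ Fin.zero) ×-dec (s Fin.≟ Fin.zero)))

  quadratic-parity : ∀ {m} → (m %ℕ 4 ≡ 2 ⊎ m %ℕ 4 ≡ 3) → ∀ p q →
                     + 4 ∣ p * p - m * (q * q) → Even p × Even q
  quadratic-parity {m} m%4 p q 4∣ = parity-zero⇒Even p′ (proj₁ zeros) , parity-zero⇒Even q′ (proj₂ zeros)
    where
    b = proj₁ (2-or-3 m m%4)
    p′ = halve p
    q′ = halve q
    zeros = quadratic-check b (parity p′) (parity q′)
      (≡₄⇒∣ (≡₄-+ (square p′) (≡₄-neg (≡₄-* (proj₂ (2-or-3 m m%4)) (square q′)))) 4∣)

  -- If the yᵢ are the doubled coordinates of an element of K, these are four times the coordinates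
  -- at 1 and at α² of its norm to ℚ(√m).
  evenPart oddPart : ℤ → (y₀ y₁ y₂ y₃ : ℤ) → ℤ
  evenPart m y₀ y₁ y₂ y₃ = y₀ * y₀ + m * (y₂ * y₂) - m * (+ 2 * (y₁ * y₃))
  oddPart m y₀ y₁ y₂ y₃ = + 2 * (y₀ * y₂) - y₁ * y₁ - m * (y₃ * y₃)

  quartic-check : ∀ b (r₀ r₁ r₂ r₃ : Fin 2) →
    + 4 ∣ evenPart (residue b) (bit r₀) (bit r₁) (bit r₂) (bit r₃) →
    + 4 ∣ oddPart (residue b) (bit r₀) (bit r₁) (bit r₂) (bit r₃) →
    r₀ ≡ Fin.zero × r₁ ≡ Fin.zero × r₂ ≡ Fin.zero × r₃ ≡ Fin.zero
  quartic-check = from-yes (Fin.all? λ b → Fin.all? λ r₀ → Fin.all? λ r₁ → Fin.all? λ r₂ → Fin.all? λ r₃ →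
    (+ 4 ∣? evenPart (residue b) (bit r₀) (bit r₁) (bit r₂) (bit r₃)) →-dec
    ((+ 4 ∣? oddPart (residue b) (bit r₀) (bit r₁) (bit r₂) (bit r₃)) →-dec
    ((r₀ Fin.≟ Fin.zero) ×-dec ((r₁ Fin.≟ Fin.zero) ×-dec ((r₂ Fin.≟ Fin.zero) ×-dec (r₃ Fin.≟ Fin.zero))))))

  quartic-parity : ∀ {m} → (m %ℕ 4 ≡ 2 ⊎ m %ℕ 4 ≡ 3) → ∀ y₀ y₁ y₂ y₃ →
    + 4 ∣ evenPart m y₀ y₁ y₂ y₃ → + 4 ∣ oddPart m y₀ y₁ y₂ y₃ →
    Even y₀ × Even y₁ × Even y₂ × Even y₃
  quartic-parity {m} m%4 y₀ y₁ y₂ y₃ 4∣even 4∣odd =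
      parity-zero⇒Even h₀ (proj₁ zeros)
    , parity-zero⇒Even h₁ (proj₁ (proj₂ zeros))
    , parity-zero⇒Even h₂ (proj₁ (proj₂ (proj₂ zeros)))
    , parity-zero⇒Even h₃ (proj₂ (proj₂ (proj₂ zeros)))
    where
    b = proj₁ (2-or-3 m m%4)
    m≡₄b = proj₂ (2-or-3 m m%4)
    h₀ = halve y₀
    h₁ = halve y₁
    h₂ = halve y₂
    h₃ = halve y₃
    zeros = quartic-check b (parity h₀) (parity h₁) (parity h₂) (parity h₃)
      (≡₄⇒∣ (≡₄-+ (≡₄-+ (square h₀) (≡₄-* m≡₄b (square h₂))) (≡₄-neg (≡₄-* m≡₄b (twice-product h₁ h₃)))) 4∣even)
      (≡₄⇒∣ (≡₄-+ (≡₄-+ (twice-product h₀ h₂) (≡₄-neg (square h₁))) (≡₄-neg (≡₄-* m≡₄b (square h₃)))) 4∣odd)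

-- Polynomial identities over ℚ behind the ring laws, conjugations, traces and norms

module CoordinateIdentities where
  open Data.Rational using (_+_; _*_; -_; _-_)

  *-comm₀ : ∀ m a b c d a′ b′ c′ d′ →
    a * a′ + m * (b * d′ + c * c′ + d * b′) ≡ a′ * a + m * (b′ * d + c′ * c + d′ * b)
  *-comm₀ = solve-∀ ℚ-ring

  *-comm₁ : ∀ m a b c d a′ b′ c′ d′ →
    a * b′ + b * a′ + m * (c * d′ + d * c′) ≡ a′ * b + b′ * a + m * (c′ * d + d′ * c)
  *-comm₁ = solve-∀ ℚ-ring

  *-comm₂ : ∀ m a b c d a′ b′ c′ d′ →
    a * c′ + b * b′ + c * a′ + m * (d * d′) ≡ a′ * c + b′ * b + c′ * a + m * (d′ * d)
  *-comm₂ = solve-∀ ℚ-ring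

  *-comm₃ : ∀ a b c d a′ b′ c′ d′ →
    a * d′ + b * c′ + c * b′ + d * a′ ≡ a′ * d + b′ * c + c′ * b + d′ * a
  *-comm₃ = solve-∀ ℚ-ring

  *-assoc₀ : ∀ m a b c d a′ b′ c′ d′ a″ b″ c″ d″ →
    (a * a′ + m * (b * d′ + c * c′ + d * b′)) * a″
      + m * ((a * b′ + b * a′ + m * (c * d′ + d * c′)) * d″
             + (a * c′ + b * b′ + c * a′ + m * (d * d′)) * c″
             + (a * d′ + b * c′ + c * b′ + d * a′) * b″)
    ≡ a * (a′ * a″ + m * (b′ * d″ + c′ * c″ + d′ * b″))
      + m * (b * (a′ * d″ + b′ * c″ + c′ * b″ + d′ * a″)
             + c * (a′ * c″ + b′ * b″ + c′ * a″ + m * (d′ * d″))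
             + d * (a′ * b″ + b′ * a″ + m * (c′ * d″ + d′ * c″)))
  *-assoc₀ = solve-∀ ℚ-ring

  *-assoc₁ : ∀ m a b c d a′ b′ c′ d′ a″ b″ c″ d″ →
    (a * a′ + m * (b * d′ + c * c′ + d * b′)) * b″
      + (a * b′ + b * a′ + m * (c * d′ + d * c′)) * a″
      + m * ((a * c′ + b * b′ + c * a′ + m * (d * d′)) * d″
             + (a * d′ + b * c′ + c * b′ + d * a′) * c″)
    ≡ a * (a′ * b″ + b′ * a″ + m * (c′ * d″ + d′ * c″))
      + b * (a′ * a″ + m * (b′ * d″ + c′ * c″ + d′ * b″))
      + m * (c * (a′ * d″ + b′ * c″ + c′ * b″ + d′ * a″)
             + d * (a′ * c″ + b′ * b″ + c′ * a″ + m * (d′ * d″)))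
  *-assoc₁ = solve-∀ ℚ-ring

  *-assoc₂ : ∀ m a b c d a′ b′ c′ d′ a″ b″ c″ d″ →
    (a * a′ + m * (b * d′ + c * c′ + d * b′)) * c″
      + (a * b′ + b * a′ + m * (c * d′ + d * c′)) * b″
      + (a * c′ + b * b′ + c * a′ + m * (d * d′)) * a″
      + m * ((a * d′ + b * c′ + c * b′ + d * a′) * d″)
    ≡ a * (a′ * c″ + b′ * b″ + c′ * a″ + m * (d′ * d″))
      + b * (a′ * b″ + b′ * a″ + m * (c′ * d″ + d′ * c″))
      + c * (a′ * a″ + m * (b′ * d″ + c′ * c″ + d′ * b″))
      + m * (d * (a′ * d″ + b′ * c″ + c′ * b″ + d′ * a″))
  *-assoc₂ = solve-∀ ℚ-ring

  *-assoc₃ : ∀ m a b c d a′ b′ c′ d′ a″ b″ c″ d″ →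
    (a * a′ + m * (b * d′ + c * c′ + d * b′)) * d″
      + (a * b′ + b * a′ + m * (c * d′ + d * c′)) * c″
      + (a * c′ + b * b′ + c * a′ + m * (d * d′)) * b″
      + (a * d′ + b * c′ + c * b′ + d * a′) * a″
    ≡ a * (a′ * d″ + b′ * c″ + c′ * b″ + d′ * a″)
      + b * (a′ * c″ + b′ * b″ + c′ * a″ + m * (d′ * d″))
      + c * (a′ * b″ + b′ * a″ + m * (c′ * d″ + d′ * c″))
      + d * (a′ * a″ + m * (b′ * d″ + c′ * c″ + d′ * b″))
  *-assoc₃ = solve-∀ ℚ-ring

  *-distrib₀ : ∀ m a b c d a′ b′ c′ d′ a″ b″ c″ d″ →
    a * (a′ + a″) + m * (b * (d′ + d″) + c * (c′ + c″) + d * (b′ + b″))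
    ≡ a * a′ + m * (b * d′ + c * c′ + d * b′) + (a * a″ + m * (b * d″ + c * c″ + d * b″))
  *-distrib₀ = solve-∀ ℚ-ring

  *-distrib₁ : ∀ m a b c d a′ b′ c′ d′ a″ b″ c″ d″ →
    a * (b′ + b″) + b * (a′ + a″) + m * (c * (d′ + d″) + d * (c′ + c″))
    ≡ a * b′ + b * a′ + m * (c * d′ + d * c′) + (a * b″ + b * a″ + m * (c * d″ + d * c″))
  *-distrib₁ = solve-∀ ℚ-ring

  *-distrib₂ : ∀ m a b c d a′ b′ c′ d′ a″ b″ c″ d″ →
    a * (c′ + c″) + b * (b′ + b″) + c * (a′ + a″) + m * (d * (d′ + d″))
    ≡ a * c′ + b * b′ + c * a′ + m * (d * d′) + (a * c″ + b * b″ + c * a″ + m * (d * d″))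
  *-distrib₂ = solve-∀ ℚ-ring

  *-distrib₃ : ∀ a b c d a′ b′ c′ d′ a″ b″ c″ d″ →
    a * (d′ + d″) + b * (c′ + c″) + c * (b′ + b″) + d * (a′ + a″)
    ≡ a * d′ + b * c′ + c * b′ + d * a′ + (a * d″ + b * c″ + c * b″ + d * a″)
  *-distrib₃ = solve-∀ ℚ-ring

  scale₀ : ∀ m k a b c d → k * a + m * (0ℚ * d + 0ℚ * c + 0ℚ * b) ≡ k * a
  scale₀ = solve-∀ ℚ-ring

  scale₁ : ∀ m k a b c d → k * b + 0ℚ * a + m * (0ℚ * d + 0ℚ * c) ≡ k * b
  scale₁ = solve-∀ ℚ-ring

  scale₂ : ∀ m k a b c d → k * c + 0ℚ * b + 0ℚ * a + m * (0ℚ * d) ≡ k * c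
  scale₂ = solve-∀ ℚ-ring

  scale₃ : ∀ k a b c d → k * d + 0ℚ * c + 0ℚ * b + 0ℚ * a ≡ k * d
  scale₃ = solve-∀ ℚ-ring

  σ-*₀ : ∀ m a b c d a′ b′ c′ d′ →
    a * a′ + m * ((- b) * (- d′) + c * c′ + (- d) * (- b′)) ≡ a * a′ + m * (b * d′ + c * c′ + d * b′)
  σ-*₀ = solve-∀ ℚ-ring

  σ-*₁ : ∀ m a b c d a′ b′ c′ d′ →
    a * (- b′) + (- b) * a′ + m * (c * (- d′) + (- d) * c′) ≡ - (a * b′ + b * a′ + m * (c * d′ + d * c′))
  σ-*₁ = solve-∀ ℚ-ring

  σ-*₂ : ∀ m a b c d a′ b′ c′ d′ →
    a * c′ + (- b) * (- b′) + c * a′ + m * ((- d) * (- d′)) ≡ a * c′ + b * b′ + c * a′ + m * (d * d′)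
  σ-*₂ = solve-∀ ℚ-ring

  σ-*₃ : ∀ a b c d a′ b′ c′ d′ →
    a * (- d′) + (- b) * c′ + c * (- b′) + (- d) * a′ ≡ - (a * d′ + b * c′ + c * b′ + d * a′)
  σ-*₃ = solve-∀ ℚ-ring

  even-*₀ : ∀ m a c a′ c′ → a * a′ + m * (0ℚ * 0ℚ + c * c′ + 0ℚ * 0ℚ) ≡ a * a′ + m * (c * c′)
  even-*₀ = solve-∀ ℚ-ring

  even-*₁ : ∀ m a c a′ c′ → a * 0ℚ + 0ℚ * a′ + m * (c * 0ℚ + 0ℚ * c′) ≡ 0ℚ
  even-*₁ = solve-∀ ℚ-ring

  even-*₂ : ∀ m a c a′ c′ → a * c′ + 0ℚ * 0ℚ + c * a′ + m * (0ℚ * 0ℚ) ≡ a * c′ + c * a′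
  even-*₂ = solve-∀ ℚ-ring

  even-*₃ : ∀ a c a′ c′ → a * 0ℚ + 0ℚ * c′ + c * 0ℚ + 0ℚ * a′ ≡ 0ℚ
  even-*₃ = solve-∀ ℚ-ring

  τ-*₀ : ∀ m a c a′ c′ → a * a′ + m * ((- c) * (- c′)) ≡ a * a′ + m * (c * c′)
  τ-*₀ = solve-∀ ℚ-ring

  τ-*₂ : ∀ a c a′ c′ → a * (- c′) + (- c) * a′ ≡ - (a * c′ + c * a′)
  τ-*₂ = solve-∀ ℚ-ring

  τ-norm₀ : ∀ m a c → a * a + m * (c * (- c)) ≡ a * a - m * (c * c)
  τ-norm₀ = solve-∀ ℚ-ring

  τ-norm₂ : ∀ a c → a * (- c) + c * a ≡ 0ℚ
  τ-norm₂ = solve-∀ ℚ-ring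

  α-*₀ : ∀ m a b c d → 0ℚ * a + m * (1ℚ * d + 0ℚ * c + 0ℚ * b) ≡ m * d
  α-*₀ = solve-∀ ℚ-ring

  α-*₁ : ∀ m a b c d → 0ℚ * b + 1ℚ * a + m * (0ℚ * d + 0ℚ * c) ≡ a
  α-*₁ = solve-∀ ℚ-ring

  α-*₂ : ∀ m a b c d → 0ℚ * c + 1ℚ * b + 0ℚ * a + m * (0ℚ * d) ≡ b
  α-*₂ = solve-∀ ℚ-ring

  α-*₃ : ∀ a b c d → 0ℚ * d + 1ℚ * c + 0ℚ * b + 0ℚ * a ≡ c
  α-*₃ = solve-∀ ℚ-ring

  σ-norm₀ : ∀ m a b c d → a * a + m * (b * (- d) + c * c + d * (- b))
                        ≡ a * a + m * (c * c) - m * (b * d + b * d)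
  σ-norm₀ = solve-∀ ℚ-ring

  σ-norm₁ : ∀ m a b c d → a * (- b) + b * a + m * (c * (- d) + d * c) ≡ 0ℚ
  σ-norm₁ = solve-∀ ℚ-ring

  σ-norm₂ : ∀ m a b c d → a * c + b * (- b) + c * a + m * (d * (- d))
                        ≡ a * c + a * c - b * b - m * (d * d)
  σ-norm₂ = solve-∀ ℚ-ring

  σ-norm₃ : ∀ a b c d → a * (- d) + b * c + c * (- b) + d * a ≡ 0ℚ
  σ-norm₃ = solve-∀ ℚ-ring

  double-norm : ∀ m a c → (a + a) * (a + a) - m * ((c + c) * (c + c)) ≡ (a * a - m * (c * c)) * ((+ 4) / 1)
  double-norm = solve-∀ ℚ-ring

  m*double-square : ∀ m a c → m * ((c + c) * (c + c)) ≡ (a + a) * (a + a) - (a * a - m * (c * c)) * ((+ 4) / 1)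
  m*double-square = solve-∀ ℚ-ring

  double-even : ∀ m a b c d →
    (a + a) * (a + a) + m * ((c + c) * (c + c)) - m * (((+ 2) / 1) * ((b + b) * (d + d)))
    ≡ (a * a + m * (c * c) - m * (b * d + b * d)) * ((+ 4) / 1)
  double-even = solve-∀ ℚ-ring

  double-odd : ∀ m a b c d →
    ((+ 2) / 1) * ((a + a) * (c + c)) - (b + b) * (b + b) - m * ((d + d) * (d + d))
    ≡ (a * c + a * c - b * b - m * (d * d)) * ((+ 4) / 1)
  double-odd = solve-∀ ℚ-ring

  m*double-square′ : ∀ m a b c d → m * ((d + d) * (d + d)) ≡
    ((+ 2) / 1) * ((a + a) * (c + c)) - (b + b) * (b + b) - (a * c + a * c - b * b - m * (d * d)) * ((+ 4) / 1)
  m*double-square′ = solve-∀ ℚ-ring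

  ½-double : ∀ q → q ≡ ½ * (q + q)
  ½-double = solve-∀ ℚ-ring

  ½-cancel : ∀ q → ½ * (q * ((+ 2) / 1)) ≡ q
  ½-cancel = solve-∀ ℚ-ring

  combination₀ : ∀ p q r s → p * 0ℚ + (q * 0ℚ + (r * 0ℚ + (s * 1ℚ + 0ℚ))) ≡ s
  combination₀ = solve-∀ ℚ-ring

  combination₁ : ∀ p q r s → p * 0ℚ + (q * 0ℚ + (r * 1ℚ + (s * 0ℚ + 0ℚ))) ≡ r
  combination₁ = solve-∀ ℚ-ring

  combination₂ : ∀ p q r s → p * 0ℚ + (q * 1ℚ + (r * 0ℚ + (s * 0ℚ + 0ℚ))) ≡ q
  combination₂ = solve-∀ ℚ-ring

  combination₃ : ∀ p q r s → p * 1ℚ + (q * 0ℚ + (r * 0ℚ + (s * 0ℚ + 0ℚ))) ≡ p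
  combination₃ = solve-∀ ℚ-ring

open CoordinateIdentities

Even⇒IsInt : ∀ {q i} → q ℚ.+ q ≐ i → Parity.Even i → IsInt q
Even⇒IsInt {q} {i} (int 2q≡i) (j , i≡2j) = j , int (begin
  q                              ≡⟨ ½-double q ⟩
  ½ ℚ.* (q ℚ.+ q)                ≡⟨ cong (½ ℚ.*_) 2q≡i ⟩
  ½ ℚ.* (i / 1)                  ≡⟨ cong (λ i → ½ ℚ.* (i / 1)) i≡2j ⟩
  ½ ℚ.* ((j ℤ.* + 2) / 1)        ≡⟨ cong (½ ℚ.*_) (/1-* j (+ 2)) ⟨
  ½ ℚ.* ((j / 1) ℚ.* ((+ 2) / 1))  ≡⟨ ½-cancel (j / 1) ⟩
  j / 1                          ∎)
  where open ≡-Reasoning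

i*j≢0 : ∀ {i j} → i ≢ 0ℤ → j ≢ 0ℤ → i ℤ.* j ≢ 0ℤ
i*j≢0 {i} i≢0 j≢0 ij≡0 with ℤ.i*j≡0⇒i≡0∨j≡0 i ij≡0
... | inj₁ i≡0 = i≢0 i≡0
... | inj₂ j≡0 = j≢0 j≡0

-- Elements whose powers have a common denominator

module BoundedElements
  {A : Set} {_+_ _*_ : A → A → A} { -_ : A → A} {0# 1# : A}
  (isCommutativeRing : IsCommutativeRing _≡_ _+_ _*_ -_ 0# 1#)
  (Int : A → Set)
  (Int-+ : ∀ {x y} → Int x → Int y → Int (x + y))
  (Int-* : ∀ {x y} → Int x → Int y → Int (x * y))
  (Int-neg : ∀ {x} → Int x → Int (- x))
  (ι : ℤ → A)
  (ι-0 : ι 0ℤ ≡ 0#)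
  (ι-1 : ι 1ℤ ≡ 1#)
  (ι-* : ∀ i j → ι (i ℤ.* j) ≡ ι i * ι j)
  (Int-ι : ∀ i → Int (ι i))
  (clear-denominators : ∀ x → ∃ λ N → N ≢ 0ℤ × Int (ι N * x))
  where

  private
    R : CommutativeRing _ _
    R = record { isCommutativeRing = isCommutativeRing }
    module R = CommutativeRing R
    open Algebra.Properties.Ring R.ring using (+-inverseˡ-unique)
    open Algebra.Solver.Ring.NaturalCoefficients.Default R.commutativeSemiring using (solve; _:*_; _:+_; _:=_)

  infixr 8 _^_
  _^_ : A → ℕ → A
  x ^ zero = 1#
  x ^ suc n = x * (x ^ n)

  lincombination : (d : ℕ) → (Fin d → ℤ) → A → A
  lincombination zero c x = 0#
  lincombination (suc d) c x = (ι (c (Fin.fromℕ d)) * (x ^ d)) + lincombination d (λ i → c (Fin.inject₁ i)) x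

  -- Almost integrality over the subring `Int`. The content is that one denominator serves all
  -- exponents; for each single power `clear-denominators` provides one anyway.
  record Bounded (x : A) : Set where
    constructor bounded
    field
      denominator : ℤ
      denominator≢0 : denominator ≢ 0ℤ
      clears : ∀ k → Int (ι denominator * (x ^ k))

  Int-0 : Int 0#
  Int-0 = subst Int ι-0 (Int-ι 0ℤ)

  Int-1 : Int 1#
  Int-1 = subst Int ι-1 (Int-ι 1ℤ)

  Int-^ : ∀ {x} → Int x → ∀ n → Int (x ^ n)
  Int-^ x zero = Int-1
  Int-^ x (suc n) = Int-* x (Int-^ x n)

  interchange : ∀ a b c d → (a * b) * (c * d) ≡ (a * c) * (b * d)
  interchange = solve 4 (λ a b c d → (a :* b) :* (c :* d) := (a :* c) :* (b :* d)) refl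

  ^-distrib-* : ∀ x y k → (x * y) ^ k ≡ (x ^ k) * (y ^ k)
  ^-distrib-* x y zero = sym (R.*-identityˡ 1#)
  ^-distrib-* x y (suc k) = trans (cong ((x * y) *_) (^-distrib-* x y k)) (interchange x y (x ^ k) (y ^ k))

  Int⇒Bounded : ∀ {x} → Int x → Bounded x
  Int⇒Bounded x = bounded 1ℤ (λ ()) (λ k → Int-* (Int-ι 1ℤ) (Int-^ x k))

  Bounded-* : ∀ {x y} → Bounded x → Bounded y → Bounded (x * y)
  Bounded-* {x} {y} (bounded D D≢0 clearsˣ) (bounded E E≢0 clearsʸ) =
    bounded (D ℤ.* E) (i*j≢0 D≢0 E≢0) λ k → subst Int
      (trans (interchange (ι D) (x ^ k) (ι E) (y ^ k))
        (sym (cong₂ _*_ (ι-* D E) (^-distrib-* x y k))))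
      (Int-* (clearsˣ k) (clearsʸ k))

  -- Splitting off one factor x + y at a time avoids the binomial theorem: the claim is generalised
  -- to xⁱyʲ(x + y)ᵏ, and lowering k raises i in one summand and j in the other.
  Bounded-+ : ∀ {x y} → Bounded x → Bounded y → Bounded (x + y)
  Bounded-+ {x} {y} (bounded D D≢0 clearsˣ) (bounded E E≢0 clearsʸ) =
    bounded (D ℤ.* E) (i*j≢0 D≢0 E≢0) λ k → subst Int
      (cong (_* ((x + y) ^ k)) (trans (cong₂ _*_ (R.*-identityʳ (ι D)) (R.*-identityʳ (ι E))) (sym (ι-* D E))))
      (mixed k 0 0)
    where
    expand : ∀ D E x y X Y P → (((D * (x * X)) * (E * Y)) * P) + (((D * X) * (E * (y * Y))) * P)
                             ≡ ((D * X) * (E * Y)) * ((x + y) * P)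
    expand = solve 7 (λ D E x y X Y P →
      (D :* (x :* X)) :* (E :* Y) :* P :+ (D :* X) :* (E :* (y :* Y)) :* P
      := (D :* X) :* (E :* Y) :* ((x :+ y) :* P)) refl

    mixed : ∀ k i j → Int (((ι D * (x ^ i)) * (ι E * (y ^ j))) * ((x + y) ^ k))
    mixed zero i j = Int-* (Int-* (clearsˣ i) (clearsʸ j)) Int-1
    mixed (suc k) i j = subst Int (expand (ι D) (ι E) x y (x ^ i) (y ^ j) ((x + y) ^ k))
      (Int-+ (mixed k (suc i) j) (mixed k i (suc j)))

  -- A relation instead of a map, so that it also covers the conjugation of ℚ(√m), which is needed
  -- only on that subfield of K.
  Bounded-related : (_~_ : A → A → Set) → 1# ~ 1# →
    (∀ {x y x′ y′} → x ~ y → x′ ~ y′ → (x * x′) ~ (y * y′)) →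
    (∀ i → ι i ~ ι i) → (∀ {x y} → x ~ y → Int x → Int y) →
    ∀ {x y} → x ~ y → Bounded x → Bounded y
  Bounded-related _~_ ~-1 ~-* ~-ι ~-Int {x} {y} x~y (bounded D D≢0 clears) =
    bounded D D≢0 λ k → ~-Int (~-* (~-ι D) (~-^ k)) (clears k)
    where
    ~-^ : ∀ k → (x ^ k) ~ (y ^ k)
    ~-^ zero = ~-1
    ~-^ (suc k) = ~-* x~y (~-^ k)

  *-lincombination-Int : ∀ d (c : Fin d → ℤ) F x →
    (∀ i → i ℕ.< d → Int (F * (x ^ i))) → Int (F * lincombination d c x)
  *-lincombination-Int zero c F x clears = subst Int (sym (R.zeroʳ F)) Int-0
  *-lincombination-Int (suc d) c F x clears = subst Int (factor F (ι (c (Fin.fromℕ d))) (x ^ d) _)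
    (Int-+ (Int-* (Int-ι _) (clears d ℕ.≤-refl))
           (*-lincombination-Int d _ F x λ i i<d → clears i (ℕ.m<n⇒m<1+n i<d)))
    where
    factor : ∀ F C X L → (C * (F * X)) + (F * L) ≡ F * ((C * X) + L)
    factor = solve 4 (λ F C X L → C :* (F :* X) :+ F :* L := F :* (C :* X :+ L)) refl

  root⇒Bounded : ∀ {x} d c → (x ^ d) + lincombination d c x ≡ 0# → Bounded x
  root⇒Bounded {x} d c root with clear-denominators x
  ... | N , N≢0 , Nx-Int = bounded (N ℤ.^ d) (^≢0 d) λ k →
        -- The window up to and including d is used because d = 0 is not excluded, and then no i < d
        -- exists.
        subst Int (R.*-identityʳ _) (window-suc k 0 z≤n)
    where
    E = ι (N ℤ.^ d)

    ^≢0 : ∀ n → N ℤ.^ n ≢ 0ℤ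
    ^≢0 zero ()
    ^≢0 (suc n) = i*j≢0 N≢0 (^≢0 n)

    -- Each of the i factors x absorbs one factor N, and the other n - i factors N are integers;
    -- this is why N is raised to the degree of the equation.
    scaled : ∀ n i → i ℕ.≤ n → Int (ι (N ℤ.^ n) * (x ^ i))
    scaled n zero i≤n = Int-* (Int-ι (N ℤ.^ n)) Int-1
    scaled (suc n) (suc i) (s≤s i≤n) = subst Int
      (trans (interchange (ι N) x (ι (N ℤ.^ n)) (x ^ i)) (cong (_* (x * (x ^ i))) (sym (ι-* N (N ℤ.^ n)))))
      (Int-* Nx-Int (scaled n i i≤n))

    reduce : ∀ F → F * (x ^ d) ≡ - (F * lincombination d c x)
    reduce F = +-inverseˡ-unique _ _
      (trans (sym (R.distribˡ F _ _)) (trans (cong (F *_) root) (R.zeroʳ F)))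

    shift : ∀ E x X P → (E * X) * (x * P) ≡ (E * (x * X)) * P
    shift = solve 4 (λ E x X P → (E :* X) :* (x :* P) := (E :* (x :* X)) :* P) refl

    -- The relation expresses x ^ (k + d) through the d preceding powers, so clearing
    -- d consecutive powers propagates upwards.
    mutual
      window : ∀ k i → i ℕ.< d → Int ((E * (x ^ k)) * (x ^ i))
      window zero i i<d = subst Int (cong (_* (x ^ i)) (sym (R.*-identityʳ E))) (scaled d i (ℕ.<⇒≤ i<d))
      window (suc k) i i<d = subst Int (shift E x (x ^ k) (x ^ i)) (window-suc k (suc i) i<d)

      window-suc : ∀ k i → i ℕ.≤ d → Int ((E * (x ^ k)) * (x ^ i))
      window-suc k i i≤d with ℕ.m≤n⇒m<n∨m≡n i≤d
      ... | inj₁ i<d = window k i i<d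
      ... | inj₂ refl = subst Int (sym (reduce (E * (x ^ k)))) (Int-neg (*-lincombination-Int d c _ x (window k)))

-- Units of ℤ[√m] and the integer equations for the coordinates of a generator

i*i≡+∣i∣*∣i∣ : ∀ i → i ℤ.* i ≡ + (∣ i ∣ ℕ.* ∣ i ∣)
i*i≡+∣i∣*∣i∣ (+ n) = sym (ℤ.pos-* n n)
i*i≡+∣i∣*∣i∣ -[1+ n ] = refl

i*j≡1⇒∣i∣≡1 : ∀ i j → i ℤ.* j ≡ 1ℤ → ∣ i ∣ ≡ 1
i*j≡1⇒∣i∣≡1 i j ij≡1 = ℕ.m*n≡1⇒m≡1 ∣ i ∣ ∣ j ∣ (trans (sym (ℤ.abs-* i j)) (cong ∣_∣ ij≡1))

∣i∣≡1⇒i≡±1 : ∀ i → ∣ i ∣ ≡ 1 → i ≡ 1ℤ ⊎ i ≡ -1ℤ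
∣i∣≡1⇒i≡±1 (+ .1) refl = inj₁ refl
∣i∣≡1⇒i≡±1 -[1+ .0 ] refl = inj₂ refl

module UnitEquations where
  open Data.Integer using (_+_; _*_; _-_; -_)

  -- The coefficient is |m|, and m < -1 makes it at least 2; with coefficient 1 the pair a = 0, b =
  -- 1 would be a further solution.
  norm-one : ∀ n a b → a ℕ.* a ℕ.+ suc (suc n) ℕ.* (b ℕ.* b) ≡ 1 → a ≡ 1 × b ≡ 0
  norm-one n a zero eq = ℕ.m*n≡1⇒m≡1 a a (trans (sym (trans (cong (a ℕ.* a ℕ.+_) (ℕ.*-zeroʳ n)) (ℕ.+-identityʳ _))) eq) , refl
  norm-one n a b@(suc _) eq = ⊥-elim (ℕ.<-irrefl (sym eq) (begin-strict
    1                                          <⟨ s≤s (s≤s z≤n) ⟩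
    2                                          ≤⟨ ℕ.m≤m+n 2 n ⟩
    suc (suc n)                                ≤⟨ ℕ.m≤m*n (suc (suc n)) (b ℕ.* b) ⟩
    suc (suc n) ℕ.* (b ℕ.* b)                  ≤⟨ ℕ.m≤n+m _ (a ℕ.* a) ⟩
    a ℕ.* a ℕ.+ suc (suc n) ℕ.* (b ℕ.* b)      ∎))
    where open ℕ.≤-Reasoning

  quadratic-norm-unit : ∀ n x z → let m = -[1+ suc n ] in
    ∣ x * x - m * (z * z) ∣ ≡ 1 → (x ≡ 1ℤ ⊎ x ≡ -1ℤ) × z ≡ 0ℤ
  quadratic-norm-unit n x z unit = ∣i∣≡1⇒i≡±1 x (proj₁ solved) , ℤ.∣i∣≡0⇒i≡0 (proj₂ solved)
    where
    open ≡-Reasoning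
    as-ℕ : x * x - -[1+ suc n ] * (z * z) ≡ + (∣ x ∣ ℕ.* ∣ x ∣ ℕ.+ suc (suc n) ℕ.* (∣ z ∣ ℕ.* ∣ z ∣))
    as-ℕ = begin
      x * x - -[1+ suc n ] * (z * z)   ≡⟨ cong (_+_ (x * x)) (ℤ.neg-distribˡ-* -[1+ suc n ] (z * z)) ⟩
      x * x + + suc (suc n) * (z * z)  ≡⟨ cong₂ (λ u v → u + + suc (suc n) * v) (i*i≡+∣i∣*∣i∣ x) (i*i≡+∣i∣*∣i∣ z) ⟩
      + (∣ x ∣ ℕ.* ∣ x ∣) + + suc (suc n) * + (∣ z ∣ ℕ.* ∣ z ∣)
                                       ≡⟨ cong (_+_ (+ (∣ x ∣ ℕ.* ∣ x ∣))) (ℤ.pos-* (suc (suc n)) (∣ z ∣ ℕ.* ∣ z ∣)) ⟨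
      + (∣ x ∣ ℕ.* ∣ x ∣) + + (suc (suc n) ℕ.* (∣ z ∣ ℕ.* ∣ z ∣)) ∎
    solved = norm-one n ∣ x ∣ ∣ z ∣ (trans (sym (cong ∣_∣ as-ℕ)) unit)

  1+4k-unit : ∀ k → ∣ 1ℤ + + 4 * k ∣ ≡ 1 → k ≡ 0ℤ
  1+4k-unit k unit = [ ≡1⇒ , (λ ≡-1 → ⊥-elim (≢-1 ≡-1)) ]′ (∣i∣≡1⇒i≡±1 (1ℤ + + 4 * k) unit)
    where
    ≡1⇒ : 1ℤ + + 4 * k ≡ 1ℤ → k ≡ 0ℤ
    ≡1⇒ ≡1 = ℤ.*-cancelˡ-≡ (+ 4) k 0ℤ (∙-cancelˡ 1ℤ (+ 4 * k) 0ℤ ≡1)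

    ≢-1 : 1ℤ + + 4 * k ≢ -1ℤ
    -- The value -1 would force 4k = -2.
    ≢-1 ≡-1 = from-no (+ 4 ∣? -[1+ 1 ])
      (divides k (trans (sym (∙-cancelˡ 1ℤ (+ 4 * k) -[1+ 1 ] ≡-1)) (ℤ.*-comm (+ 4) k)))

  brahmagupta : ∀ m x z u v → (x * x - m * (z * z)) * (u * u - m * (v * v))
    ≡ (x * u + m * (z * v)) * (x * u + m * (z * v)) - m * ((x * v + z * u) * (x * v + z * u))
  brahmagupta = solve-ℤ

  -- gᵢ and hᵢ are the coordinates of γ² and γ³, for γ = a + xα + yα² + zα³, and lᵢ below
  -- those of k₀ + k₁γ + k₂γ² + k₃γ³.
  module Powers (m a x y z : ℤ) where
    g₀ g₁ g₂ g₃ h₁ h₂ h₃ : ℤ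
    g₀ = a * a + m * (x * z + y * y + z * x)
    g₁ = a * x + x * a + m * (y * z + z * y)
    g₂ = a * y + x * x + y * a + m * (z * z)
    g₃ = a * z + x * y + y * x + z * a
    h₁ = a * g₁ + x * g₀ + m * (y * g₃ + z * g₂)
    h₂ = a * g₂ + x * g₁ + y * g₀ + m * (z * g₃)
    h₃ = a * g₃ + x * g₂ + y * g₁ + z * g₀

  -- The factors in parentheses on the right are u and v; the left-hand sides expand
  -- lᵢ below, because the solver treats defined names as constants.
  coefficient₁ : ∀ m a x y z k₀ k₁ k₂ k₃ →
    k₃ * (a * (a * x + x * a + m * (y * z + z * y))
          + x * (a * a + m * (x * z + y * y + z * x))
          + m * (y * (a * z + x * y + y * x + z * a) + z * (a * y + x * x + y * a + m * (z * z))))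
      + (k₂ * (a * x + x * a + m * (y * z + z * y)) + (k₁ * x + (k₀ * 0ℤ + 0ℤ)))
    ≡ x * (k₁ + + 2 * a * k₂ + k₃ * (+ 3 * (a * a + m * (y * y)) + + 2 * m * (x * z)))
      + m * (z * (+ 2 * y * k₂ + k₃ * (+ 6 * a * y + x * x + m * (z * z))))
  coefficient₁ = solve-ℤ

  coefficient₃ : ∀ m a x y z k₀ k₁ k₂ k₃ →
    k₃ * (a * (a * z + x * y + y * x + z * a)
          + x * (a * y + x * x + y * a + m * (z * z))
          + y * (a * x + x * a + m * (y * z + z * y))
          + z * (a * a + m * (x * z + y * y + z * x)))
      + (k₂ * (a * z + x * y + y * x + z * a) + (k₁ * z + (k₀ * 0ℤ + 0ℤ)))
    ≡ x * (+ 2 * y * k₂ + k₃ * (+ 6 * a * y + x * x + m * (z * z)))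
      + z * (k₁ + + 2 * a * k₂ + k₃ * (+ 3 * (a * a + m * (y * y)) + + 2 * m * (x * z)))
  coefficient₃ = solve-ℤ

  -- The combination x²v + 2y²u - 2y·l₂ is chosen to eliminate k₁ and k₂. What remains beside k₃ is
  -- the factor x⁴ + 4my⁴ of the index form at z = 0.
  coefficient₂ : ∀ m a x y k₀ k₁ k₂ k₃ →
    k₃ * (x * x * (x * x) + + 4 * (m * (y * y * (y * y))))
    ≡ x * x * (+ 2 * y * k₂ + k₃ * (+ 6 * a * y + x * x + m * (0ℤ * 0ℤ)))
      + + 2 * (y * y) * (k₁ + + 2 * a * k₂ + k₃ * (+ 3 * (a * a + m * (y * y)) + + 2 * m * (x * 0ℤ)))
      - + 2 * y * (k₃ * (a * (a * y + x * x + y * a + m * (0ℤ * 0ℤ))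
                    + x * (a * x + x * a + m * (y * 0ℤ + 0ℤ * y))
                    + y * (a * a + m * (x * 0ℤ + y * y + 0ℤ * x))
                    + m * (0ℤ * (a * 0ℤ + x * y + y * x + 0ℤ * a)))
                + (k₂ * (a * y + x * x + y * a + m * (0ℤ * 0ℤ)) + (k₁ * y + (k₀ * 0ℤ + 0ℤ))))
  coefficient₂ = solve-ℤ

  module Coefficients (m a x y z k₀ k₁ k₂ k₃ : ℤ) where
    open Powers m a x y z

    -- With E = a + yα² and O = xα + zα³, u + vα² is k₁ + 2k₂E + k₃(3E² + O²), the quotient of the
    -- odd part of the cubic at E + O by O.
    u v : ℤ
    u = k₁ + + 2 * a * k₂ + k₃ * (+ 3 * (a * a + m * (y * y)) + + 2 * m * (x * z))
    v = + 2 * y * k₂ + k₃ * (+ 6 * a * y + x * x + m * (z * z))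

    l₁ l₂ l₃ : ℤ
    l₁ = k₃ * h₁ + (k₂ * g₁ + (k₁ * x + (k₀ * 0ℤ + 0ℤ)))
    l₂ = k₃ * h₂ + (k₂ * g₂ + (k₁ * y + (k₀ * 0ℤ + 0ℤ)))
    l₃ = k₃ * h₃ + (k₂ * g₃ + (k₁ * z + (k₀ * 0ℤ + 0ℤ)))

    -- The two hypotheses say (x + zα²)(u + vα²) = 1; taking norms from ℚ(√m) turns this into a
    -- factorisation of 1 in ℤ.
    x²-mz²-unit : l₁ ≡ 1ℤ → l₃ ≡ 0ℤ → ∣ x * x - m * (z * z) ∣ ≡ 1
    x²-mz²-unit l₁≡1 l₃≡0 = i*j≡1⇒∣i∣≡1 (x * x - m * (z * z)) (u * u - m * (v * v)) (begin
      (x * x - m * (z * z)) * (u * u - m * (v * v))   ≡⟨ brahmagupta m x z u v ⟩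
      (x * u + m * (z * v)) * (x * u + m * (z * v)) - m * ((x * v + z * u) * (x * v + z * u))
        ≡⟨ cong₂ (λ p q → p * p - m * (q * q))
             (trans (sym (coefficient₁ m a x y z k₀ k₁ k₂ k₃)) l₁≡1)
             (trans (sym (coefficient₃ m a x y z k₀ k₁ k₂ k₃)) l₃≡0) ⟩
      1ℤ - m * 0ℤ                                     ≡⟨ cong (λ i → 1ℤ - i) (ℤ.*-zeroʳ m) ⟩
      1ℤ                                              ∎)
      where open ≡-Reasoning

  module _ (m a x y k₀ k₁ k₂ k₃ : ℤ) where
    open Coefficients m a x y 0ℤ k₀ k₁ k₂ k₃

    y≡0 : m ≢ 0ℤ → x * x ≡ 1ℤ → l₁ ≡ 1ℤ → l₂ ≡ 0ℤ → l₃ ≡ 0ℤ → y ≡ 0ℤ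
    y≡0 m≢0 x²≡1 l₁≡1 l₂≡0 l₃≡0 = square-zero y (square-zero (y * y) y⁴≡0)
      where
      open ≡-Reasoning
      T = 1ℤ + + 4 * (m * (y * y * (y * y)))

      square-zero : ∀ i → i * i ≡ 0ℤ → i ≡ 0ℤ
      square-zero i i²≡0 with ℤ.i*j≡0⇒i≡0∨j≡0 i i²≡0
      ... | inj₁ i≡0 = i≡0
      ... | inj₂ i≡0 = i≡0

      u≡x : u ≡ x
      u≡x = begin
        u              ≡⟨ ℤ.*-identityˡ u ⟨
        1ℤ * u         ≡⟨ cong (_* u) x²≡1 ⟨
        x * x * u      ≡⟨ drop x u m v ⟩
        x * (x * u + m * (0ℤ * v))    ≡⟨ cong (x *_) (trans (sym (coefficient₁ m a x y 0ℤ k₀ k₁ k₂ k₃)) l₁≡1) ⟩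
        x * 1ℤ         ≡⟨ ℤ.*-identityʳ x ⟩
        x              ∎
        where
        drop : ∀ x u m v → x * x * u ≡ x * (x * u + m * (0ℤ * v))
        drop = solve-ℤ

      v≡0 : v ≡ 0ℤ
      v≡0 = begin
        v              ≡⟨ ℤ.*-identityˡ v ⟨
        1ℤ * v         ≡⟨ cong (_* v) x²≡1 ⟨
        x * x * v      ≡⟨ drop x u v ⟩
        x * (x * v + 0ℤ * u)    ≡⟨ cong (x *_) (trans (sym (coefficient₃ m a x y 0ℤ k₀ k₁ k₂ k₃)) l₃≡0) ⟩
        x * 0ℤ         ≡⟨ ℤ.*-zeroʳ x ⟩
        0ℤ             ∎
        where
        drop : ∀ x u v → x * x * v ≡ x * (x * v + 0ℤ * u)
        drop = solve-ℤ

      k₃T : k₃ * T ≡ + 2 * (y * y) * x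
      k₃T = begin
        k₃ * (1ℤ + + 4 * (m * (y * y * (y * y))))
          ≡⟨ cong (λ i → k₃ * (i * i + + 4 * (m * (y * y * (y * y))))) x²≡1 ⟨
        k₃ * (x * x * (x * x) + + 4 * (m * (y * y * (y * y))))
          ≡⟨ coefficient₂ m a x y k₀ k₁ k₂ k₃ ⟩
        x * x * v + + 2 * (y * y) * u - + 2 * y * l₂
          ≡⟨ cong₂ (λ i j → x * x * i + + 2 * (y * y) * j - + 2 * y * l₂) v≡0 u≡x ⟩
        x * x * 0ℤ + + 2 * (y * y) * x - + 2 * y * l₂
          ≡⟨ cong (λ i → x * x * 0ℤ + + 2 * (y * y) * x - + 2 * y * i) l₂≡0 ⟩
        x * x * 0ℤ + + 2 * (y * y) * x - + 2 * y * 0ℤ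
          ≡⟨ drop x y ⟩
        + 2 * (y * y) * x ∎
        where
        drop : ∀ x y → x * x * 0ℤ + + 2 * (y * y) * x - + 2 * y * 0ℤ ≡ + 2 * (y * y) * x
        drop = solve-ℤ

      -- 4my⁴ is a multiple of 2y²x = k₃T, and T = 1 + 4my⁴.
      T-unit : T * (1ℤ - + 2 * m * x * (y * y) * k₃) ≡ 1ℤ
      T-unit = begin
        T * (1ℤ - + 2 * m * x * (y * y) * k₃)                 ≡⟨ expand T (+ 2 * m * x * (y * y)) k₃ ⟩
        T - + 2 * m * x * (y * y) * (k₃ * T)                  ≡⟨ cong (λ i → T - + 2 * m * x * (y * y) * i) k₃T ⟩
        T - + 2 * m * x * (y * y) * (+ 2 * (y * y) * x)       ≡⟨ collect m x y T ⟩
        T - + 4 * (m * (y * y * (y * y))) * (x * x)           ≡⟨ cong (λ i → T - + 4 * (m * (y * y * (y * y))) * i) x²≡1 ⟩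
        T - + 4 * (m * (y * y * (y * y))) * 1ℤ                ≡⟨ cancel (+ 4 * (m * (y * y * (y * y)))) ⟩
        1ℤ                                                    ∎
        where
        expand : ∀ T s k → T * (1ℤ - s * k) ≡ T - s * (k * T)
        expand = solve-ℤ
        collect : ∀ m x y T → T - + 2 * m * x * (y * y) * (+ 2 * (y * y) * x) ≡ T - + 4 * (m * (y * y * (y * y))) * (x * x)
        collect = solve-ℤ
        cancel : ∀ s → 1ℤ + s - s * 1ℤ ≡ 1ℤ
        cancel = solve-ℤ

      y⁴≡0 : y * y * (y * y) ≡ 0ℤ
      y⁴≡0 = [ (λ m≡0 → ⊥-elim (m≢0 m≡0)) , (λ eq → eq) ]′
        (ℤ.i*j≡0⇒i≡0∨j≡0 m (1+4k-unit (m * (y * y * (y * y))) (i*j≡1⇒∣i∣≡1 T (1ℤ - + 2 * m * x * (y * y) * k₃) T-unit)))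

-- K as a commutative ring

module _ (m : ℤ) where
  private
    M : ℚ
    M = m / 1

    M≐m : M ≐ m
    M≐m = int refl

    +4≐ : (+ 4) / 1 ≐ + 4
    +4≐ = int refl

    +2≐ : (+ 2) / 1 ≐ + 2
    +2≐ = int refl

    infixl 6 _∔_
    infixl 7 _·_
    _∔_ _·_ : K → K → K
    _∔_ = _+K_ m
    _·_ = _*K_ m

  +K-assoc : ∀ x y z → (x ∔ y) ∔ z ≡ x ∔ (y ∔ z)
  +K-assoc x y z = K-ext (ℚ.+-assoc (c0 x) _ _) (ℚ.+-assoc (c1 x) _ _) (ℚ.+-assoc (c2 x) _ _) (ℚ.+-assoc (c3 x) _ _)

  +K-comm : ∀ x y → x ∔ y ≡ y ∔ x
  +K-comm x y = K-ext (ℚ.+-comm (c0 x) _) (ℚ.+-comm (c1 x) _) (ℚ.+-comm (c2 x) _) (ℚ.+-comm (c3 x) _)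

  +K-identityˡ : ∀ x → 0K m ∔ x ≡ x
  +K-identityˡ x = K-ext (ℚ.+-identityˡ _) (ℚ.+-identityˡ _) (ℚ.+-identityˡ _) (ℚ.+-identityˡ _)

  -K-inverseˡ : ∀ x → -_K m x ∔ x ≡ 0K m
  -K-inverseˡ x = K-ext (ℚ.+-inverseˡ (c0 x)) (ℚ.+-inverseˡ (c1 x)) (ℚ.+-inverseˡ (c2 x)) (ℚ.+-inverseˡ (c3 x))

  *K-comm : ∀ x y → x · y ≡ y · x
  *K-comm ⟨ a , b , c , d ⟩ ⟨ a′ , b′ , c′ , d′ ⟩ = K-ext
    (*-comm₀ M a b c d a′ b′ c′ d′) (*-comm₁ M a b c d a′ b′ c′ d′)
    (*-comm₂ M a b c d a′ b′ c′ d′) (*-comm₃ a b c d a′ b′ c′ d′)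

  *K-assoc : ∀ x y z → (x · y) · z ≡ x · (y · z)
  *K-assoc ⟨ a , b , c , d ⟩ ⟨ a′ , b′ , c′ , d′ ⟩ ⟨ a″ , b″ , c″ , d″ ⟩ = K-ext
    (*-assoc₀ M a b c d a′ b′ c′ d′ a″ b″ c″ d″) (*-assoc₁ M a b c d a′ b′ c′ d′ a″ b″ c″ d″)
    (*-assoc₂ M a b c d a′ b′ c′ d′ a″ b″ c″ d″) (*-assoc₃ M a b c d a′ b′ c′ d′ a″ b″ c″ d″)

  *K-distribˡ-+K : ∀ x y z → x · (y ∔ z) ≡ x · y ∔ x · z
  *K-distribˡ-+K ⟨ a , b , c , d ⟩ ⟨ a′ , b′ , c′ , d′ ⟩ ⟨ a″ , b″ , c″ , d″ ⟩ = K-ext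
    (*-distrib₀ M a b c d a′ b′ c′ d′ a″ b″ c″ d″) (*-distrib₁ M a b c d a′ b′ c′ d′ a″ b″ c″ d″)
    (*-distrib₂ M a b c d a′ b′ c′ d′ a″ b″ c″ d″) (*-distrib₃ a b c d a′ b′ c′ d′ a″ b″ c″ d″)

  ℚ-scale : ∀ k x → ⟨ k , 0ℚ , 0ℚ , 0ℚ ⟩ · x ≡ ⟨ k ℚ.* c0 x , k ℚ.* c1 x , k ℚ.* c2 x , k ℚ.* c3 x ⟩
  ℚ-scale k ⟨ a , b , c , d ⟩ = K-ext (scale₀ M k a b c d) (scale₁ M k a b c d) (scale₂ M k a b c d) (scale₃ k a b c d)

  *K-identityˡ : ∀ x → 1K m · x ≡ x
  *K-identityˡ x = trans (ℚ-scale 1ℚ x)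
    (K-ext (ℚ.*-identityˡ _) (ℚ.*-identityˡ _) (ℚ.*-identityˡ _) (ℚ.*-identityˡ _))

  K-commutativeRing : CommutativeRing _ _
  K-commutativeRing = record
    { Carrier = K ; _≈_ = _≡_ ; _+_ = _+K_ m ; _*_ = _*K_ m ; -_ = -_K m ; 0# = 0K m ; 1# = 1K m
    ; isCommutativeRing = record
      { isRing = record
        { +-isAbelianGroup = record
          { isGroup = record
            { isMonoid = record
              { isSemigroup = record
                { isMagma = record { isEquivalence = isEquivalence ; ∙-cong = cong₂ _ }
                ; assoc = +K-assoc }
              ; identity = +K-identityˡ , λ x → trans (+K-comm x _) (+K-identityˡ x) }
            ; inverse = -K-inverseˡ , (λ x → trans (+K-comm x _) (-K-inverseˡ x))
            ; ⁻¹-cong = cong _ }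
          ; comm = +K-comm }
        ; *-cong = cong₂ _
        ; *-assoc = *K-assoc
        ; *-identity = *K-identityˡ , λ x → trans (*K-comm x _) (*K-identityˡ x)
        ; distrib = *K-distribˡ-+K ,
            λ x y z → trans (*K-comm _ x) (trans (*K-distribˡ-+K x y z) (cong₂ (_+K_ m) (*K-comm x y) (*K-comm x z))) }
      ; *-comm = *K-comm } }

  -- The subring ℤ[α] and the bounded elements of K

  record Int (x : K) : Set where
    constructor integral
    field
      i0 : IsInt (c0 x)
      i1 : IsInt (c1 x)
      i2 : IsInt (c2 x)
      i3 : IsInt (c3 x)

  Int-+ : ∀ {x y} → Int x → Int y → Int (x ∔ y)
  Int-+ (integral a b c d) (integral a′ b′ c′ d′) =
    integral (IsInt-+ a a′) (IsInt-+ b b′) (IsInt-+ c c′) (IsInt-+ d d′)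

  Int-neg : ∀ {x} → Int x → Int (-_K m x)
  Int-neg (integral a b c d) = integral (IsInt-neg a) (IsInt-neg b) (IsInt-neg c) (IsInt-neg d)

  Int-* : ∀ {x y} → Int x → Int y → Int (x · y)
  Int-* (integral a b c d) (integral a′ b′ c′ d′) =
    integral (a * a′ + m-int * (b * d′ + c * c′ + d * b′))
             (a * b′ + b * a′ + m-int * (c * d′ + d * c′))
             (a * c′ + b * b′ + c * a′ + m-int * (d * d′))
             (a * d′ + b * c′ + c * b′ + d * a′)
    where
    infixl 6 _+_
    infixl 7 _*_
    _+_ : ∀ {p q} → IsInt p → IsInt q → IsInt (p ℚ.+ q)
    _+_ = IsInt-+
    _*_ : ∀ {p q} → IsInt p → IsInt q → IsInt (p ℚ.* q)
    _*_ = IsInt-*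
    m-int = /1-int m

  Int-ι : ∀ i → Int (ι m i)
  Int-ι i = integral (/1-int i) (/1-int 0ℤ) (/1-int 0ℤ) (/1-int 0ℤ)

  ι-* : ∀ i j → ι m (i ℤ.* j) ≡ ι m i · ι m j
  ι-* i j = sym (trans (ℚ-scale (i / 1) (ι m j))
    (K-ext (/1-* i j) (ℚ.*-zeroʳ (i / 1)) (ℚ.*-zeroʳ (i / 1)) (ℚ.*-zeroʳ (i / 1))))

  clear-denominators : ∀ x → ∃ λ N → N ≢ 0ℤ × Int (ι m N · x)
  clear-denominators x@(⟨ a , b , c , d ⟩) = N , N≢0 , subst Int (sym (ℚ-scale (N / 1) x))
      (integral (clear (↧ b ℤ.* ↧ c ℤ.* ↧ d) a (eqa (↧ a) (↧ b) (↧ c) (↧ d)))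
                (clear (↧ a ℤ.* ↧ c ℤ.* ↧ d) b (eqb (↧ a) (↧ b) (↧ c) (↧ d)))
                (clear (↧ a ℤ.* ↧ b ℤ.* ↧ d) c (eqc (↧ a) (↧ b) (↧ c) (↧ d)))
                (clear (↧ a ℤ.* ↧ b ℤ.* ↧ c) d refl))
    where
    N = ↧ a ℤ.* ↧ b ℤ.* ↧ c ℤ.* ↧ d
    ↧≢0 : ∀ q → ↧ q ≢ 0ℤ
    ↧≢0 (mkℚ _ _ _) ()
    N≢0 : N ≢ 0ℤ
    N≢0 = i*j≢0 (i*j≢0 (i*j≢0 (↧≢0 a) (↧≢0 b)) (↧≢0 c)) (↧≢0 d)
    clear : ∀ k q → N ≡ k ℤ.* ↧ q → IsInt ((N / 1) ℚ.* q)
    clear k q N≡k*↧q = k ℤ.* ↥ q , int (begin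
      (N / 1) ℚ.* q                      ≡⟨ cong (λ N → (N / 1) ℚ.* q) N≡k*↧q ⟩
      ((k ℤ.* ↧ q) / 1) ℚ.* q            ≡⟨ cong (ℚ._* q) (/1-* k (↧ q)) ⟨
      ((k / 1) ℚ.* (↧ q / 1)) ℚ.* q      ≡⟨ ℚ.*-assoc (k / 1) (↧ q / 1) q ⟩
      (k / 1) ℚ.* ((↧ q / 1) ℚ.* q)      ≡⟨ cong ((k / 1) ℚ.*_) (trans (ℚ.*-comm (↧ q / 1) q) (*-↧ q)) ⟩
      (k / 1) ℚ.* (↥ q / 1)              ≡⟨ /1-* k (↥ q) ⟩
      (k ℤ.* ↥ q) / 1                    ∎)
      where open ≡-Reasoning
    eqa : ∀ a b c d → a ℤ.* b ℤ.* c ℤ.* d ≡ b ℤ.* c ℤ.* d ℤ.* a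
    eqa = solve-ℤ
    eqb : ∀ a b c d → a ℤ.* b ℤ.* c ℤ.* d ≡ a ℤ.* c ℤ.* d ℤ.* b
    eqb = solve-ℤ
    eqc : ∀ a b c d → a ℤ.* b ℤ.* c ℤ.* d ≡ a ℤ.* b ℤ.* d ℤ.* c
    eqc = solve-ℤ

  open BoundedElements (CommutativeRing.isCommutativeRing K-commutativeRing) Int Int-+ Int-* Int-neg
    (ι m) refl refl ι-* Int-ι clear-denominators public

  ^-agrees : ∀ x n → _^K_ m x n ≡ x ^ n
  ^-agrees x zero = refl
  ^-agrees x (suc n) = cong (x ·_) (^-agrees x n)

  lincomb-agrees : ∀ d c x → lincomb m d c x ≡ lincombination d c x
  lincomb-agrees zero c x = refl
  lincomb-agrees (suc d) c x = cong₂ _∔_ (cong (ι m (c (Fin.fromℕ d)) ·_) (^-agrees x d)) (lincomb-agrees d _ x)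

  IsAlgInt⇒Bounded : ∀ {x} → IsAlgInt m x → Bounded x
  IsAlgInt⇒Bounded {x} (d , c , root) =
    root⇒Bounded d c (trans (sym (cong₂ _∔_ (^-agrees x d) (lincomb-agrees d c x))) root)

  -- The numbers Drᵏ form a geometric sequence of integers with ratio r and nonzero first term D.
  Bounded-rational⇒IsInt : ∀ {r} → Bounded ⟨ r , 0ℚ , 0ℚ , 0ℚ ⟩ → IsInt r
  Bounded-rational⇒IsInt {r} (bounded D D≢0 clears) =
    geometric⇒IsInt r s ratio (λ k → Int.i0 (clears k)) s₀≢0
    where
    open CommutativeRing K-commutativeRing using (*-commutativeSemigroup; *-identityʳ)
    open Algebra.Properties.CommutativeSemigroup *-commutativeSemigroup using (x∙yz≈y∙xz)
    x = ⟨ r , 0ℚ , 0ℚ , 0ℚ ⟩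
    s : ℕ → ℚ
    s k = c0 (ι m D · (x ^ k))
    ratio : ∀ k → s (suc k) ≡ r ℚ.* s k
    ratio k = cong c0 (trans (x∙yz≈y∙xz (ι m D) x (x ^ k)) (ℚ-scale r _))
    s₀≢0 : s 0 ≢ 0ℚ
    s₀≢0 s₀≡0 = D≢0 (/1-injective {D} {0ℤ} (trans (sym (cong c0 (*-identityʳ (ι m D)))) s₀≡0))

  -- Conjugation of K over ℚ(√m), and of ℚ(√m) over ℚ

  σ : K → K
  σ ⟨ a , b , c , d ⟩ = ⟨ a , ℚ.- b , c , ℚ.- d ⟩

  σ-* : ∀ x y → σ x · σ y ≡ σ (x · y)
  σ-* ⟨ a , b , c , d ⟩ ⟨ a′ , b′ , c′ , d′ ⟩ = K-ext
    (σ-*₀ M a b c d a′ b′ c′ d′) (σ-*₁ M a b c d a′ b′ c′ d′)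
    (σ-*₂ M a b c d a′ b′ c′ d′) (σ-*₃ a b c d a′ b′ c′ d′)

  σ-Bounded : ∀ {x} → Bounded x → Bounded (σ x)
  σ-Bounded {x} = Bounded-related (λ x y → σ x ≡ y) refl
    (λ {x} {y} {x′} {y′} σx≡y σx′≡y′ → trans (sym (σ-* x x′)) (cong₂ _·_ σx≡y σx′≡y′))
    (λ i → refl)
    (λ σx≡y x → subst Int σx≡y (integral (Int.i0 x) (IsInt-neg (Int.i1 x)) (Int.i2 x) (IsInt-neg (Int.i3 x))))
    {x} {σ x} refl

  even : ℚ → ℚ → K
  even a c = ⟨ a , 0ℚ , c , 0ℚ ⟩

  even-* : ∀ a c a′ c′ → even a c · even a′ c′ ≡ even (a ℚ.* a′ ℚ.+ M ℚ.* (c ℚ.* c′)) (a ℚ.* c′ ℚ.+ c ℚ.* a′)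
  even-* a c a′ c′ = K-ext (even-*₀ M a c a′ c′) (even-*₁ M a c a′ c′) (even-*₂ M a c a′ c′) (even-*₃ a c a′ c′)

  -- Being an inductive family, a proof also records that both elements lie in ℚ(√m), where negating
  -- the α² coordinate is multiplicative.
  data Conjugate : K → K → Set where
    conjugate : ∀ a c → Conjugate (even a c) (even a (ℚ.- c))

  Conjugate-* : ∀ {x y x′ y′} → Conjugate x y → Conjugate x′ y′ → Conjugate (x · x′) (y · y′)
  Conjugate-* (conjugate a c) (conjugate a′ c′) = subst₂ Conjugate
    (sym (even-* a c a′ c′))
    (trans (cong₂ even (sym (τ-*₀ M a c a′ c′)) (sym (τ-*₂ a c a′ c′))) (sym (even-* a (ℚ.- c) a′ (ℚ.- c′))))
    (conjugate _ _)

  even-Bounded-conjugate : ∀ {a c} → Bounded (even a c) → Bounded (even a (ℚ.- c))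
  even-Bounded-conjugate {a} {c} = Bounded-related Conjugate (conjugate 1ℚ 0ℚ) Conjugate-*
    (λ i → conjugate (i / 1) 0ℚ) Conjugate-Int (conjugate a c)
    where
    Conjugate-Int : ∀ {x y} → Conjugate x y → Int x → Int y
    Conjugate-Int (conjugate a c) x = integral (Int.i0 x) (Int.i1 x) (IsInt-neg (Int.i2 x)) (Int.i3 x)

  -- Bounded elements have integer coordinates

  module _ (m-squarefree : SquareFree m) (m%4 : (m %ℕ 4 ≡ 2 ⊎ m %ℕ 4 ≡ 3)) where

    -- Trace and norm give 2a and N = a² - mc² in ℤ. Then m(2c)² = (2a)² - 4N is an integer, so 2c
    -- is one by squarefreeness, and 4N is a form whose divisibility by 4 makes 2a and 2c even.
    even-integral : ∀ {a c} → Bounded (even a c) → IsInt a × IsInt c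
    even-integral {a} {c} t = Even⇒IsInt 2a≐p (proj₁ p,q-Even) , Even⇒IsInt 2c≐q (proj₂ p,q-Even)
      where
      t̄ = even-Bounded-conjugate t

      2a-int : IsInt (a ℚ.+ a)
      2a-int = Bounded-rational⇒IsInt (subst Bounded
        (K-ext refl refl (ℚ.+-inverseʳ c) refl) (Bounded-+ t t̄))

      norm-int : IsInt (a ℚ.* a ℚ.- M ℚ.* (c ℚ.* c))
      norm-int = Bounded-rational⇒IsInt (subst Bounded
        (trans (even-* a c a (ℚ.- c)) (K-ext (τ-norm₀ M a c) refl (τ-norm₂ a c) refl)) (Bounded-* t t̄))

      2c-int : IsInt (c ℚ.+ c)
      2c-int = squarefree⇒IsInt {m} m-squarefree (c ℚ.+ c) (subst IsInt (sym (m*double-square M a c))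
        (IsInt-+ (IsInt-* 2a-int 2a-int) (IsInt-neg (IsInt-* norm-int (+ 4 , +4≐)))))

      p = proj₁ 2a-int
      q = proj₁ 2c-int
      2a≐p = proj₂ 2a-int
      2c≐q = proj₂ 2c-int

      4∣ : + 4 ∣ p ℤ.* p ℤ.- m ℤ.* (q ℤ.* q)
      4∣ = divides (proj₁ norm-int) (≐-unique
        (2a≐p ⊗ 2a≐p ⊕ ⊖ (M≐m ⊗ (2c≐q ⊗ 2c≐q)))
        (subst (_≐ proj₁ norm-int ℤ.* + 4) (sym (double-norm M a c)) (proj₂ norm-int ⊗ +4≐)))

      p,q-Even : Parity.Even p × Parity.Even q
      p,q-Even = Parity.quadratic-parity {m} m%4 p q 4∣

    trace-integral : ∀ {a b c d} → Bounded ⟨ a , b , c , d ⟩ → IsInt (a ℚ.+ a) × IsInt (c ℚ.+ c)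
    trace-integral {a} {b} {c} {d} x = even-integral (subst Bounded
      (K-ext refl (ℚ.+-inverseʳ b) refl (ℚ.+-inverseʳ d)) (Bounded-+ x (σ-Bounded x)))

    Int-α : Int (α m)
    Int-α = integral (/1-int 0ℤ) (/1-int 1ℤ) (/1-int 0ℤ) (/1-int 0ℤ)

    -- Traces to ℚ(√m) reach 2a, 2b and 2c. The norm to ℚ(√m) then reaches 2d, and both of its
    -- coordinates are needed for the congruences modulo 4.
    Bounded⇒Int : ∀ x → Bounded x → Int x
    Bounded⇒Int ⟨ a , b , c , d ⟩ x = integral
        (Even⇒IsInt (proj₂ 2a-int) (proj₁ ys-Even))
        (Even⇒IsInt (proj₂ 2b-int) (proj₁ (proj₂ ys-Even)))
        (Even⇒IsInt (proj₂ 2c-int) (proj₁ (proj₂ (proj₂ ys-Even))))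
        (Even⇒IsInt (proj₂ 2d-int) (proj₂ (proj₂ (proj₂ ys-Even))))
      where
      2a-int : IsInt (a ℚ.+ a)
      2a-int = proj₁ (trace-integral x)

      2c-int : IsInt (c ℚ.+ c)
      2c-int = proj₂ (trace-integral x)

      -- The trace kills the odd coordinates; multiplication by α first moves b to the coordinate at
      -- α².
      2b-int : IsInt (b ℚ.+ b)
      2b-int = proj₂ (trace-integral (subst Bounded
        (K-ext (α-*₀ M a b c d) (α-*₁ M a b c d) (α-*₂ M a b c d) (α-*₃ a b c d))
        (Bounded-* (Int⇒Bounded Int-α) x)))

      norm-integral : IsInt (a ℚ.* a ℚ.+ M ℚ.* (c ℚ.* c) ℚ.- M ℚ.* (b ℚ.* d ℚ.+ b ℚ.* d))
                    × IsInt (a ℚ.* c ℚ.+ a ℚ.* c ℚ.- b ℚ.* b ℚ.- M ℚ.* (d ℚ.* d))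
      norm-integral = even-integral (subst Bounded
        (K-ext (σ-norm₀ M a b c d) (σ-norm₁ M a b c d) (σ-norm₂ M a b c d) (σ-norm₃ a b c d))
        (Bounded-* x (σ-Bounded x)))

      N₀-int = proj₁ norm-integral
      N₂-int = proj₂ norm-integral

      -- The same shift turns d into md, so only 2md would come out as an integer. The α² coordinate
      -- of the norm contains md² instead, to which squarefreeness applies.
      2d-int : IsInt (d ℚ.+ d)
      2d-int = squarefree⇒IsInt {m} m-squarefree (d ℚ.+ d) (subst IsInt (sym (m*double-square′ M a b c d))
        (IsInt-+ (IsInt-+ (IsInt-* (+ 2 , +2≐) (IsInt-* 2a-int 2c-int)) (IsInt-neg (IsInt-* 2b-int 2b-int)))
                 (IsInt-neg (IsInt-* N₂-int (+ 4 , +4≐)))))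

      y₀ = proj₁ 2a-int
      y₁ = proj₁ 2b-int
      y₂ = proj₁ 2c-int
      y₃ = proj₁ 2d-int

      4∣even : + 4 ∣ Parity.evenPart m y₀ y₁ y₂ y₃
      4∣even = divides (proj₁ N₀-int) (≐-unique
        (proj₂ 2a-int ⊗ proj₂ 2a-int ⊕ M≐m ⊗ (proj₂ 2c-int ⊗ proj₂ 2c-int)
          ⊕ ⊖ (M≐m ⊗ (+2≐ ⊗ (proj₂ 2b-int ⊗ proj₂ 2d-int))))
        (subst (_≐ proj₁ N₀-int ℤ.* + 4) (sym (double-even M a b c d)) (proj₂ N₀-int ⊗ +4≐)))

      4∣odd : + 4 ∣ Parity.oddPart m y₀ y₁ y₂ y₃
      4∣odd = divides (proj₁ N₂-int) (≐-unique
        (+2≐ ⊗ (proj₂ 2a-int ⊗ proj₂ 2c-int) ⊕ ⊖ (proj₂ 2b-int ⊗ proj₂ 2b-int)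
          ⊕ ⊖ (M≐m ⊗ (proj₂ 2d-int ⊗ proj₂ 2d-int)))
        (subst (_≐ proj₁ N₂-int ℤ.* + 4) (sym (double-odd M a b c d)) (proj₂ N₂-int ⊗ +4≐)))

      ys-Even : Parity.Even y₀ × Parity.Even y₁ × Parity.Even y₂ × Parity.Even y₃
      ys-Even = Parity.quartic-parity {m} m%4 y₀ y₁ y₂ y₃ 4∣even 4∣odd

  -- Integral combinations of powers: the basis given by α, and the coordinates for a general γ

  scale : ℤ → K → K
  scale k x = ⟨ (k / 1) ℚ.* c0 x , (k / 1) ℚ.* c1 x , (k / 1) ℚ.* c2 x , (k / 1) ℚ.* c3 x ⟩

  lincomb-4 : ∀ c x → lincomb m 4 c x ≡
    scale (c 3F) (x · (x · x)) ∔ (scale (c 2F) (x · x) ∔ (scale (c 1F) x ∔ (scale (c 0F) (1K m) ∔ 0K m)))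
  lincomb-4 c x = cong₂ _∔_ (term 3F (cong (λ y → x · (x · y)) x¹≡x))
    (cong₂ _∔_ (term 2F (cong (x ·_) x¹≡x)) (cong₂ _∔_ (term 1F x¹≡x) (cong (_∔ 0K m) (term 0F refl))))
    where
    x¹≡x : x · 1K m ≡ x
    x¹≡x = CommutativeRing.*-identityʳ K-commutativeRing x
    term : ∀ i {y z} → y ≡ z → ι m (c i) · y ≡ scale (c i) z
    term i {y} {z} y≡z = trans (cong (ι m (c i) ·_) y≡z) (ℚ-scale (c i / 1) z)

  α-* : ∀ a b c d → α m · ⟨ a , b , c , d ⟩ ≡ ⟨ M ℚ.* d , a , b , c ⟩
  α-* a b c d = K-ext (α-*₀ M a b c d) (α-*₁ M a b c d) (α-*₂ M a b c d) (α-*₃ a b c d)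

  α² : α m · α m ≡ ⟨ 0ℚ , 0ℚ , 1ℚ , 0ℚ ⟩
  α² = trans (α-* 0ℚ 1ℚ 0ℚ 0ℚ) (K-ext (ℚ.*-zeroʳ M) refl refl refl)

  α³ : α m · (α m · α m) ≡ ⟨ 0ℚ , 0ℚ , 0ℚ , 1ℚ ⟩
  α³ = trans (cong (α m ·_) α²) (trans (α-* 0ℚ 0ℚ 1ℚ 0ℚ) (K-ext (ℚ.*-zeroʳ M) refl refl refl))

  α⁴ : _^K_ m (α m) 4 ≡ ⟨ M , 0ℚ , 0ℚ , 0ℚ ⟩
  α⁴ = trans (cong (λ x → α m · (α m · (α m · x))) (CommutativeRing.*-identityʳ K-commutativeRing (α m)))
    (trans (cong (α m ·_) α³) (trans (α-* 0ℚ 0ℚ 0ℚ 1ℚ) (K-ext (ℚ.*-identityʳ M) refl refl refl)))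

  lincomb-α : ∀ c → lincomb m 4 c (α m) ≡ ⟨ c 0F / 1 , c 1F / 1 , c 2F / 1 , c 3F / 1 ⟩
  lincomb-α c = trans (lincomb-4 c (α m)) (trans
    (cong₂ (λ x y → scale (c 3F) x ∔ (scale (c 2F) y ∔ (scale (c 1F) (α m) ∔ (scale (c 0F) (1K m) ∔ 0K m)))) α³ α²)
    (K-ext (combination₀ (c 3F / 1) (c 2F / 1) (c 1F / 1) (c 0F / 1))
           (combination₁ (c 3F / 1) (c 2F / 1) (c 1F / 1) (c 0F / 1))
           (combination₂ (c 3F / 1) (c 2F / 1) (c 1F / 1) (c 0F / 1))
           (combination₃ (c 3F / 1) (c 2F / 1) (c 1F / 1) (c 0F / 1))))

  digits : ℤ → ℤ → ℤ → ℤ → Fin 4 → ℤ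
  digits a b c d 0F = a
  digits a b c d 1F = b
  digits a b c d 2F = c
  digits a b c d 3F = d

  α-IsAlgInt : IsAlgInt m (α m)
  α-IsAlgInt = 4 , digits (ℤ.- m) 0ℤ 0ℤ 0ℤ , trans (cong₂ _∔_ α⁴ (lincomb-α (digits (ℤ.- m) 0ℤ 0ℤ 0ℤ)))
    (K-ext (trans (cong (M ℚ.+_) (sym (_≐_.equality (⊖_ {i = m} (int refl))))) (ℚ.+-inverseʳ M)) refl refl refl)

  α-independent : ∀ c → lincomb m 4 c (α m) ≡ 0K m → ∀ i → c i ≡ 0ℤ
  α-independent c lincomb≡0 i = zeros i
    where
    coordinates≡0 = trans (sym (lincomb-α c)) lincomb≡0
    zeros : ∀ i → c i ≡ 0ℤ
    zeros 0F = /1-injective {c 0F} {0ℤ} (cong c0 coordinates≡0)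
    zeros 1F = /1-injective {c 1F} {0ℤ} (cong c1 coordinates≡0)
    zeros 2F = /1-injective {c 2F} {0ℤ} (cong c2 coordinates≡0)
    zeros 3F = /1-injective {c 3F} {0ℤ} (cong c3 coordinates≡0)

  Int⇒lincomb-α : ∀ {x} → Int x → Σ (Fin 4 → ℤ) λ c → x ≡ lincomb m 4 c (α m)
  Int⇒lincomb-α (integral (a , a≐) (b , b≐) (c , c≐) (d , d≐)) = digits a b c d ,
    trans (K-ext (_≐_.equality a≐) (_≐_.equality b≐) (_≐_.equality c≐) (_≐_.equality d≐)) (sym (lincomb-α (digits a b c d)))

  module LincombCoefficients (a x y z : ℤ) (k : Fin 4 → ℤ) where
    open UnitEquations.Coefficients m a x y z (k 0F) (k 1F) (k 2F) (k 3F) using (l₁; l₂; l₃)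
    open UnitEquations.Powers m a x y z

    γ γ² γ³ : K
    γ = ⟨ a / 1 , x / 1 , y / 1 , z / 1 ⟩
    γ² = γ · γ
    γ³ = γ · γ²

    private
      a≐ : a / 1 ≐ a
      a≐ = int refl
      x≐ : x / 1 ≐ x
      x≐ = int refl
      y≐ : y / 1 ≐ y
      y≐ = int refl
      z≐ : z / 1 ≐ z
      z≐ = int refl
      k≐ : ∀ i → k i / 1 ≐ k i
      k≐ i = int refl
      0≐ : 0ℚ ≐ 0ℤ
      0≐ = int refl

    -- The integer expressions keep the exact shape of the product in K and of `lincomb-4`, down to
    -- the summand `k₀ * 0ℤ + 0ℤ` left by the constant term and the empty sum. Each proof is
    -- therefore the formula itself, read in `⊕` and `⊗`.
    g₀≐ : c0 γ² ≐ g₀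
    g₀≐ = a≐ ⊗ a≐ ⊕ M≐m ⊗ (x≐ ⊗ z≐ ⊕ y≐ ⊗ y≐ ⊕ z≐ ⊗ x≐)
    g₁≐ : c1 γ² ≐ g₁
    g₁≐ = a≐ ⊗ x≐ ⊕ x≐ ⊗ a≐ ⊕ M≐m ⊗ (y≐ ⊗ z≐ ⊕ z≐ ⊗ y≐)
    g₂≐ : c2 γ² ≐ g₂
    g₂≐ = a≐ ⊗ y≐ ⊕ x≐ ⊗ x≐ ⊕ y≐ ⊗ a≐ ⊕ M≐m ⊗ (z≐ ⊗ z≐)
    g₃≐ : c3 γ² ≐ g₃
    g₃≐ = a≐ ⊗ z≐ ⊕ x≐ ⊗ y≐ ⊕ y≐ ⊗ x≐ ⊕ z≐ ⊗ a≐

    h₁≐ : c1 γ³ ≐ h₁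
    h₁≐ = a≐ ⊗ g₁≐ ⊕ x≐ ⊗ g₀≐ ⊕ M≐m ⊗ (y≐ ⊗ g₃≐ ⊕ z≐ ⊗ g₂≐)
    h₂≐ : c2 γ³ ≐ h₂
    h₂≐ = a≐ ⊗ g₂≐ ⊕ x≐ ⊗ g₁≐ ⊕ y≐ ⊗ g₀≐ ⊕ M≐m ⊗ (z≐ ⊗ g₃≐)
    h₃≐ : c3 γ³ ≐ h₃
    h₃≐ = a≐ ⊗ g₃≐ ⊕ x≐ ⊗ g₂≐ ⊕ y≐ ⊗ g₁≐ ⊕ z≐ ⊗ g₀≐

    l₁≐ : c1 (lincomb m 4 k γ) ≐ l₁
    l₁≐ = subst (_≐ l₁) (sym (cong c1 (lincomb-4 k γ)))
      (k≐ 3F ⊗ h₁≐ ⊕ (k≐ 2F ⊗ g₁≐ ⊕ (k≐ 1F ⊗ x≐ ⊕ (k≐ 0F ⊗ 0≐ ⊕ 0≐))))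
    l₂≐ : c2 (lincomb m 4 k γ) ≐ l₂
    l₂≐ = subst (_≐ l₂) (sym (cong c2 (lincomb-4 k γ)))
      (k≐ 3F ⊗ h₂≐ ⊕ (k≐ 2F ⊗ g₂≐ ⊕ (k≐ 1F ⊗ y≐ ⊕ (k≐ 0F ⊗ 0≐ ⊕ 0≐))))
    l₃≐ : c3 (lincomb m 4 k γ) ≐ l₃
    l₃≐ = subst (_≐ l₃) (sym (cong c3 (lincomb-4 k γ)))
      (k≐ 3F ⊗ h₃≐ ⊕ (k≐ 2F ⊗ g₃≐ ⊕ (k≐ 1F ⊗ z≐ ⊕ (k≐ 0F ⊗ 0≐ ⊕ 0≐))))

    module _ (α≡lincomb : α m ≡ lincomb m 4 k γ) where
      l₁≡1 : l₁ ≡ 1ℤ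
      l₁≡1 = ≐-unique l₁≐ (subst (_≐ 1ℤ) (cong c1 α≡lincomb) (int refl))
      l₂≡0 : l₂ ≡ 0ℤ
      l₂≡0 = ≐-unique l₂≐ (subst (_≐ 0ℤ) (cong c2 α≡lincomb) (int refl))
      l₃≡0 : l₃ ≡ 0ℤ
      l₃≡0 = ≐-unique l₃≐ (subst (_≐ 0ℤ) (cong c3 α≡lincomb) (int refl))

-- From a generator to its equivalence with α

γ-coordinates : ∀ m n → m ≡ -[1+ suc n ] → ∀ a x y z k →
  α m ≡ lincomb m 4 k ⟨ a / 1 , x / 1 , y / 1 , z / 1 ⟩ → (x ≡ 1ℤ ⊎ x ≡ -1ℤ) × y ≡ 0ℤ × z ≡ 0ℤ
γ-coordinates m n m≡ a x y z k α≡ = proj₁ x,z , y≡0′ z (proj₂ x,z) α≡ , proj₂ x,z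
  where
  open UnitEquations
  x,z : (x ≡ 1ℤ ⊎ x ≡ -1ℤ) × z ≡ 0ℤ
  x,z = quadratic-norm-unit n x z (subst (λ m → ∣ x ℤ.* x ℤ.- m ℤ.* (z ℤ.* z) ∣ ≡ 1) m≡
    (Coefficients.x²-mz²-unit m a x y z (k 0F) (k 1F) (k 2F) (k 3F)
      (LincombCoefficients.l₁≡1 m a x y z k α≡) (LincombCoefficients.l₃≡0 m a x y z k α≡)))
  x²≡1 : x ≡ 1ℤ ⊎ x ≡ -1ℤ → x ℤ.* x ≡ 1ℤ
  x²≡1 (inj₁ refl) = refl
  x²≡1 (inj₂ refl) = refl
  m≢0 : m ≢ 0ℤ
  m≢0 m≡0 = contradiction (trans (sym m≡) m≡0) λ ()
  -- Taking `z` as an argument lets `refl` replace it by 0 in the equation for α too, which the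
  -- equations with z = 0 require.
  y≡0′ : ∀ z → z ≡ 0ℤ → α m ≡ lincomb m 4 k ⟨ a / 1 , x / 1 , y / 1 , z / 1 ⟩ → y ≡ 0ℤ
  y≡0′ .0ℤ refl α≡ = y≡0 m a x y (k 0F) (k 1F) (k 2F) (k 3F) m≢0 (x²≡1 (proj₁ x,z))
    (LincombCoefficients.l₁≡1 m a x y 0ℤ k α≡)
    (LincombCoefficients.l₂≡0 m a x y 0ℤ k α≡)
    (LincombCoefficients.l₃≡0 m a x y 0ℤ k α≡)

Equivalent-α : ∀ m a x → x ≡ 1ℤ ⊎ x ≡ -1ℤ → Equivalent m ⟨ a / 1 , x / 1 , 0ℚ , 0ℚ ⟩ (α m)
Equivalent-α m a x (inj₁ refl) = inj₂ (a , K-ext (ℚ.+-identityʳ (a / 1)) refl refl refl)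
Equivalent-α m a x (inj₂ refl) = inj₁ (a , K-ext (ℚ.+-identityʳ (a / 1)) refl refl refl)

generator⇒Equivalent : ∀ m n → m ≡ -[1+ suc n ] → ∀ a x y z k →
  α m ≡ lincomb m 4 k ⟨ a / 1 , x / 1 , y / 1 , z / 1 ⟩ → Equivalent m ⟨ a / 1 , x / 1 , y / 1 , z / 1 ⟩ (α m)
generator⇒Equivalent m n m≡ a x y z k α≡ =
  subst₂ (λ y z → Equivalent m ⟨ a / 1 , x / 1 , y / 1 , z / 1 ⟩ (α m))
    (sym (proj₁ (proj₂ solved))) (sym (proj₂ (proj₂ solved))) (Equivalent-α m a x (proj₁ solved))
  where
  solved = γ-coordinates m n m≡ a x y z k α≡

<-1⇒ : ∀ m → m < -[1+ 0 ] → ∃ λ n → m ≡ -[1+ suc n ]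
<-1⇒ -[1+ zero ] (-<- ())
<-1⇒ -[1+ suc n ] m<-1 = n , refl

spanned-α⇒Equivalent : ∀ m → (∃ λ n → m ≡ -[1+ suc n ]) → ∀ γ → Int m γ →
  (∃ λ k → α m ≡ lincomb m 4 k γ) → Equivalent m γ (α m)
spanned-α⇒Equivalent m (n , m≡) ⟨ _ , _ , _ , _ ⟩ (integral (a , int refl) (x , int refl) (y , int refl) (z , int refl)) (k , α≡) =
  generator⇒Equivalent m n m≡ a x y z k α≡

theorem1 : (m : ℤ) → m < -[1+ 0 ] → SquareFree m
    → (m %ℕ 4 ≡ 2 ⊎ m %ℕ 4 ≡ 3)
    → GeneratesPowerIntegralBasis m (α m)
    × (∀ γ → GeneratesPowerIntegralBasis m γ → Equivalent m γ (α m))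
theorem1 m m<-1 m-squarefree m%4 =
  (α-IsAlgInt m , (λ x x-integer → Int⇒lincomb-α m (integer⇒Int x x-integer)) , α-independent m) , equivalent
  where
  integer⇒Int : ∀ x → IsAlgInt m x → Int m x
  integer⇒Int x x-integer = Bounded⇒Int m m-squarefree m%4 x (IsAlgInt⇒Bounded m x-integer)

  equivalent : ∀ γ → GeneratesPowerIntegralBasis m γ → Equivalent m γ (α m)
  equivalent γ (γ-integer , spans , _) =
    spanned-α⇒Equivalent m (<-1⇒ m m<-1) γ (integer⇒Int γ γ-integer) (spans (α m) (α-IsAlgInt m))
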